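{- Let $\varepsilon,\beta,\delta,r>0$ and let $f$ be a function with range $[1,r]$ that is monotone on all input sequences and has static global sensitivity $\rho$, where $r$ and $\rho$ are publicly known parameters. There exists an $\varepsilon$-differentially private dynamic algorithm with multiplicative error $(1+\beta)$, additive error $O\big(\rho\log(r)\log(T)/(\varepsilon\log(1+\beta))\big)$ and failure probability $\delta$ that computes $f$. Here $T$ is the length of the input sequence.
   Context: The input is a sequence $(G_1,\dots,G_T)$ of data sets (e.g. graphs) evolving by updates; a dynamic algorithm outputs, after each update $t$, an answer $a_t$ for $f(G_t)$, using only the input up to time $t$. The static global sensitivity of $f$ is the maximum of $|f(G)-f(G')|$ over all adjacent inputs $G,G'$ (for graphs under edge-adjacency: graphs that differ in one edge). Monotone on all input sequences means that the values $f(G_1),f(G_2),\dots$ are non-decreasing on every valid input sequence, or non-increasing on every valid input sequence. Adjacency of input sequences is event-level: two sequences of equal length are adjacent if they differ in a single update (e.g. the insertion, or the deletion, of one edge at one time step); then the inputs at each time step are equal or adjacent. A randomized algorithm $\mathcal A$ is $\varepsilon$-differentially private if $\Pr[\mathcal A(\mathcal G)\in S]\le e^{\varepsilon}\Pr[\mathcal A(\mathcal G')\in S]$ for all adjacent input sequences $\mathcal G,\mathcal G'$ and all sets $S$ of output sequences. Multiplicative error $(1+\beta)$, additive error $\alpha$ and failure probability $\delta$ mean that, with probability at least $1-\delta$ over the coins of the whole algorithm, $f(G_t)-\alpha\le a_t\le(1+\beta)f(G_t)+\alpha$ for all $t$. -}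

module Defs where

open import Algebra.Bundles using (CommutativeRing)
import Algebra.Construct.NaturalChoice.Max as Max
import Algebra.Properties.CommutativeMonoid.Sum as Sum
import Algebra.Properties.Semiring.Exp as Exp
import Algebra.Properties.Semiring.Mult as Mult
open import Axiom.ExcludedMiddle using (ExcludedMiddle)
open import Data.Fin.Base using (Fin; toℕ)
import Data.Fin.Base as Fin
open import Data.Fin.Properties using (toℕ<n)
open import Data.Nat.Base using (ℕ; suc; _!)
import Data.Nat.Base as ℕ
open import Data.Product.Base using (∃; _×_; _,_)
open import Data.Sum.Base using (_⊎_)
open import Data.Vec.Base using (Vec; []; _∷_; lookup; truncate)
open import Level using (0ℓ) renaming (suc to lsuc)
open import Relation.Binary.Bundles using (TotalOrder)
open import Relation.Binary.Core using (Rel)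
import Relation.Binary.Construct.NonStrictToStrict as NonStrictToStrict
open import Relation.Binary.PropositionalEquality.Core using (_≡_; _≢_)
open import Relation.Binary.Structures using (IsTotalOrder)
open import Relation.Nullary.Decidable.Core using (yes; no)
open import Relation.Nullary.Negation.Core using (¬_)
open import Relation.Unary using (Pred; _≐_; _⊥_; ∁; U; ⋃)

-- The real numbers, axiomatised as a Dedekind-complete totally ordered field
-- (unique up to isomorphism).  The inverse is total; its value at 0# is
-- unspecified.
record RealNumbers : Set₁ where
  infix  4 _≤_
  infix  8 _⁻¹
  field
    commutativeRing : CommutativeRing 0ℓ 0ℓ

  open CommutativeRing commutativeRing public
    renaming (Carrier to ℝ)

  field
    _≤_          : Rel ℝ 0ℓ
    isTotalOrder : IsTotalOrder _≈_ _≤_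
    +-monoˡ-≤    : ∀ z {x y} → x ≤ y → x + z ≤ y + z
    *-nonneg     : ∀ {x y} → 0# ≤ x → 0# ≤ y → 0# ≤ x * y
    0≉1          : ¬ (0# ≈ 1#)
    _⁻¹          : ℝ → ℝ
    *-inverseʳ   : ∀ {x} → ¬ (x ≈ 0#) → x * x ⁻¹ ≈ 1#

  UpperBound : Pred ℝ 0ℓ → Pred ℝ 0ℓ
  UpperBound P b = ∀ x → P x → x ≤ b

  field
    supremum : ∀ (P : Pred ℝ 0ℓ) → ∃ P → ∃ (UpperBound P) →
               ∃ λ s → UpperBound P s × (∀ b → UpperBound P b → s ≤ b)

  totalOrder : TotalOrder 0ℓ 0ℓ 0ℓ
  totalOrder = record { isTotalOrder = isTotalOrder }

  open NonStrictToStrict _≈_ _≤_ public using (_<_)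
  open Max totalOrder public using (_⊔_)
  open Exp semiring public using (_^_)
  open Mult semiring public using () renaming (_×_ to _·_)
  open Sum +-commutativeMonoid public using (sum)

  infixl 7 _/_
  _/_ : ℝ → ℝ → ℝ
  x / y = x * y ⁻¹

  ∣_∣ : ℝ → ℝ
  ∣ x ∣ = x ⊔ - x

  fromℕ : ℕ → ℝ
  fromℕ n = n · 1#

  ∑[i<_]_ : ℕ → (ℕ → ℝ) → ℝ
  ∑[i< n ] t = sum {n} (λ i → t (toℕ i))

  infix 4 _⟶_
  _⟶_ : (ℕ → ℝ) → ℝ → Set
  s ⟶ l = ∀ η → 0# < η → ∃ λ N → ∀ n → N ℕ.≤ n → ∣ s n - l ∣ ≤ η

-- The initial state is not part of the trajectory.
trajectory : ∀ {D U : Set} {T} → (D → U → D) → D → Vec U T → Vec D T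
trajectory f d []       = []
trajectory f d (u ∷ us) = f d u ∷ trajectory f (f d u) us

-- A dynamic problem: data sets evolving by updates from an initial data set.
-- u ∼ᵤ u′ means that the updates u and u′ of one time step differ by a single
-- elementary event (for graphs: the insertion, or the deletion, of one edge).
-- It is a parameter, rather than u ≢ u′, because an update may bundle several
-- elementary events, and because replacing one edge by another is not a single
-- event.
record DynamicProblem : Set₁ where
  infix 4 _∼_ _∼ᵤ_
  field
    Data    : Set
    Update  : Set
    initial : Data
    apply   : Data → Update → Data
    Valid   : ∀ {T} → Pred (Vec Update T) 0ℓ
    _∼_     : Rel Data 0ℓ
    _∼ᵤ_    : Rel Update 0ℓ

  states : ∀ {T} → Vec Update T → Vec Data T
  states = trajectory apply initial

  EventAdjacent : ∀ {T} → Rel (Vec Update T) 0ℓ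
  EventAdjacent us us′ =
    ∃ λ t → lookup us t ∼ᵤ lookup us′ t ×
            (∀ s → s ≢ t → lookup us s ≡ lookup us′ s)

  field
    states-adjacent : ∀ {T} {us us′ : Vec Update T} →
      Valid us → Valid us′ → EventAdjacent us us′ →
      ∀ t → lookup (states us) t ≡ lookup (states us′) t
          ⊎ lookup (states us) t ∼ lookup (states us′) t

module Privacy (em : ExcludedMiddle 0ℓ) (ℛ : RealNumbers) where

  open RealNumbers ℛ

  -- Junk value 0# for divergent sequences.
  lim : (ℕ → ℝ) → ℝ
  lim s with em {∃ λ l → s ⟶ l}
  ... | yes (l , _) = l
  ... | no  _       = 0#

  exp : ℝ → ℝ
  exp x = lim λ n → ∑[i< n ] λ i → x ^ i / fromℕ (i !)

  -- Junk value 0# for arguments that are not positive.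
  log : ℝ → ℝ
  log x with em {∃ λ y → exp y ≈ x}
  ... | yes (y , _) = y
  ... | no  _       = 0#

  -- Pr is total, but constrained on events only.
  record ProbabilitySpace : Set₂ where
    field
      Ω         : Set
      IsEvent   : Pred (Pred Ω 0ℓ) (lsuc 0ℓ)
      event-≐   : ∀ {E F} → E ≐ F → IsEvent E → IsEvent F
      event-U   : IsEvent U
      event-∁   : ∀ {E} → IsEvent E → IsEvent (∁ E)
      event-⋃   : ∀ {E : ℕ → Pred Ω 0ℓ} → (∀ n → IsEvent (E n)) → IsEvent (⋃ ℕ E)
      Pr        : Pred Ω 0ℓ → ℝ
      Pr-≐      : ∀ {E F} → IsEvent E → E ≐ F → Pr E ≈ Pr F
      Pr-nonneg : ∀ {E} → IsEvent E → 0# ≤ Pr E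
      Pr-U      : Pr U ≈ 1#
      Pr-⋃      : ∀ {E : ℕ → Pred Ω 0ℓ} → (∀ n → IsEvent (E n)) →
                  (∀ {m n} → m ≢ n → E m ⊥ E n) →
                  (λ n → ∑[i< n ] λ i → Pr (E i)) ⟶ Pr (⋃ ℕ E)

  -- Product Borel σ-algebra on the sequences of T real outputs.
  data Borel {T : ℕ} : Pred (Pred (Fin T → ℝ) 0ℓ) (lsuc 0ℓ) where
    half-space : ∀ t c → Borel (λ a → a t ≤ c)
    complement : ∀ {S} → Borel S → Borel (∁ S)
    union      : ∀ {S : ℕ → Pred (Fin T → ℝ) 0ℓ} →
                 (∀ n → Borel (S n)) → Borel (⋃ ℕ S)
    resp-≐     : ∀ {S S′} → S ≐ S′ → Borel S → Borel S′

  -- A randomized dynamic algorithm for input sequences of length T.  The coins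
  -- ω are drawn once, independently of the input; the answer at time t is a
  -- function of ω and of the input up to time t.
  record DynamicAlgorithm (Data : Set) (T : ℕ) : Set₂ where
    field
      coins : ProbabilitySpace

    open ProbabilitySpace coins public

    field
      answer     : (t : Fin T) → Vec Data (suc (toℕ t)) → Ω → ℝ
      measurable : ∀ t Gs c → IsEvent (λ ω → answer t Gs ω ≤ c)

    outputs : Vec Data T → Ω → Fin T → ℝ
    outputs Gs ω t = answer t (truncate (toℕ<n t) Gs) ω

  module _ (𝒫 : DynamicProblem) where

    open DynamicProblem 𝒫

    HasRange : ℝ → ℝ → Pred (Data → ℝ) 0ℓ
    HasRange a b f = ∀ G → a ≤ f G × f G ≤ b

    NonDecreasing NonIncreasing MonotoneOnAllInputs : Pred (Data → ℝ) 0ℓ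
    NonDecreasing f = ∀ {T} {us : Vec Update T} → Valid us → ∀ {s t} → s Fin.≤ t →
                      f (lookup (states us) s) ≤ f (lookup (states us) t)
    NonIncreasing f = ∀ {T} {us : Vec Update T} → Valid us → ∀ {s t} → s Fin.≤ t →
                      f (lookup (states us) t) ≤ f (lookup (states us) s)
    MonotoneOnAllInputs f = NonDecreasing f ⊎ NonIncreasing f

    LipschitzBound : (Data → ℝ) → Pred ℝ 0ℓ
    LipschitzBound f b = 0# ≤ b × (∀ {G G′} → G ∼ G′ → ∣ f G - f G′ ∣ ≤ b)

    -- The supremum, taken in [0,∞), of ∣ f G - f G′ ∣ over adjacent G and G′.
    IsSensitivity : (Data → ℝ) → Pred ℝ 0ℓ
    IsSensitivity f ρ = LipschitzBound f ρ × (∀ b → LipschitzBound f b → ρ ≤ b)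

    DifferentiallyPrivate : ∀ {T} → ℝ → Pred (DynamicAlgorithm Data T) (lsuc 0ℓ)
    DifferentiallyPrivate {T} ε 𝒜 =
      ∀ {us us′ : Vec Update T} → Valid us → Valid us′ → EventAdjacent us us′ →
      ∀ {S : Pred (Fin T → ℝ) 0ℓ} → Borel S →
      Pr (λ ω → S (outputs (states us) ω)) ≤ exp ε * Pr (λ ω → S (outputs (states us′) ω))
      where open DynamicAlgorithm 𝒜

    -- 𝒜 computes f with multiplicative error μ, additive error α and failure
    -- probability δ.
    Computes : ∀ {T} → (Data → ℝ) → (μ α δ : ℝ) → Pred (DynamicAlgorithm Data T) 0ℓ
    Computes {T} f μ α δ 𝒜 =
      ∀ {us : Vec Update T} → Valid us →
      1# - δ ≤ Pr (λ ω → ∀ t →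
        let y = f (lookup (states us) t)
            a = outputs (states us) ω t
        in (y - α ≤ a) × (a ≤ μ * y + α))
      where open DynamicAlgorithm 𝒜

{-# OPTIONS --safe #-}

-- Sparse vector technique with one-sided, finitely supported noise.  Rounding f
-- to a grid of width ρ / m gives natural scores x of sensitivity m.  A state
-- j ≤ K, which encodes the power of 1 + β that is output, only ever increases: at
-- time t it is raised to the level of (x_t ∸ Z) + Y_t, where Z is drawn once
-- and Y_t afresh.  To pass to a neighbouring input, Z is shifted by m, which
-- preserves the times without a jump, and Y_t by at most 2 m at each of the at
-- most K jumps, which preserves the new state.  Both shifts go upwards, so
-- geometric noise on ℕ suffices; a shift by one costs a factor exp θ, and
-- (m + 2 m K) θ = ε.  Scores are bounded by some R, noise beyond R has the same
-- effect as R, and so the coins are finite.  As f is monotone, the state at time t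
-- lies between the levels of x_t ∸ i and x_t + i as soon as all noises are at
-- most i.  An increasing f is underestimated by shifting the levels by i, a
-- decreasing f is reflected to R ∸ x.  If ρ = 0 or r ≤ 1 + β, the outputs f and r
-- need no noise.

module Submission where

open import Algebra.Solver.Ring.AlmostCommutativeRing
  using (fromCommutativeRing; _-Raw-AlmostCommutative⟶_)
import Algebra.Construct.NaturalChoice.Max as NaturalChoiceMax
import Algebra.Construct.NaturalChoice.MaxOp as NaturalChoiceMaxOp
import Algebra.Properties.Ring as RingProperties
import Algebra.Properties.Semiring.Exp as SemiringExp
import Algebra.Properties.Semiring.Mult as SemiringMult
import Algebra.Properties.Semiring.Mult.TCOptimised as SemiringMultTCO
import Algebra.Properties.Semiring.Sum as SemiringSum
import Algebra.Solver.Ring as RingSolver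
open import Axiom.ExcludedMiddle using (ExcludedMiddle)
open import Data.Fin.Base using (Fin; zero; suc; toℕ)
import Data.Fin.Base as Fin
open import Data.Fin.Properties using (toℕ<n)
open import Data.Integer.Base using (ℤ; -[1+_])
import Data.Integer.Base as ℤ
import Data.Integer.Properties as ℤ
open import Data.Maybe.Base using (Maybe; just; nothing)
open import Data.Nat.Base using (ℕ; zero; suc; z≤n; s≤s; _!)
import Data.Nat.Base as ℕ
import Data.Nat.Properties as ℕ
open import Data.Nat.Solver using (module +-*-Solver)
open import Data.Product.Base using (∃; _×_; _,_; proj₁; proj₂)
open import Data.Sum.Base using (_⊎_; inj₁; inj₂; [_,_]′)
open import Data.Unit.Base using (⊤; tt)
open import Data.Vec.Base using (Vec; []; _∷_; last; lookup; truncate)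
import Data.Vec.Base as Vec
open import Data.Vec.Properties using (lookup-map)
open import Data.Vec.Relation.Binary.Pointwise.Inductive using (Pointwise; []; _∷_)
open import Data.Vec.Relation.Unary.All using (All; []; _∷_)
open import Function.Base using (_∘_)
open import Level using (0ℓ; Lift; lift) renaming (suc to lsuc)
open import Relation.Binary.Bundles using (TotalOrder)
import Relation.Binary.Construct.NonStrictToStrict as NonStrictToStrict
open import Relation.Binary.PropositionalEquality as ≡ using (_≡_; _≢_)
import Relation.Binary.Reasoning.PartialOrder as PartialOrderReasoning
open import Relation.Binary.Structures using (IsTotalOrder)
open import Relation.Nullary.Decidable.Core using (yes; no)
open import Relation.Nullary.Negation.Core using (¬_; contradiction)
open import Relation.Unary using (Pred; _⊥_; ⋃)
open import Defs

-- One changed update can alter the scores at every later time, so a privacy cost per time step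
-- would enter the error as a factor T. Here only jumps cost, and there are at most K = floor (log r
-- / log (1 + β)). With θ = ε / (m + 2 m K) all noises are of order log T / θ cells of width ρ / m,
-- hence an error of order ρ (1 + 2 K) log T / ε. In it m cancels, so m is free; m ≥ ε gives θ ≤ 1,
-- so that rounding the noise bound up to an integer is absorbed by log T. This absorption needs T ≥
-- 2.
--
-- Noise may only lower the estimate. The output is a power of 1 + β rounded up, so an overestimate
-- of the score by i cells would become an additive error of (1 + β) i cells, and no constant
-- independent of β bounds that. This is why the levels are shifted, so that in both directions of
-- monotonicity the whole uncertainty of 2 i cells lies below the true score.
--
-- Monotonicity makes an irrevocable state harmless: a level reached on account of an earlier score
-- is still justified by the present one.

private module ℕ-Solver = +-*-Solver

module _ (em : ExcludedMiddle 0ℓ) (ℛ : RealNumbers) where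

  open RealNumbers ℛ
  open Privacy em ℛ

  -- Arithmetic of a complete ordered field.

  module OrderedField where

    open IsTotalOrder isTotalOrder public using (antisym; total)
      renaming (refl to ≤-refl; trans to ≤-trans; reflexive to ≤-reflexive)
    open TotalOrder totalOrder using (poset)
    open PartialOrderReasoning poset public
    open RingProperties ring public using (-‿+-comm; -‿distribˡ-*; -0#≈0#; -‿involutive)
    open SemiringMult semiring public using (×-homo-+; ×1-homo-*)
    open SemiringExp semiring public using (^-congˡ; ^-homo-*)

    -- Coefficients in ℤ have an equality test that computes, which lets the ring solver cancel
    -- terms. The multiple `_×′_` is used because `1 ×′ 1#` reduces to `1#`, so that `:1` stands for
    -- `1#` itself.
    module ℤ-solver where

      open SemiringMultTCO semiring using (1+×) renaming (_×_ to _×′_; ×-homo-+ to ×′-homo-+; ×1-homo-* to ×′1-homo-*)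

      ⟦_⟧ : ℤ → ℝ
      ⟦ ℤ.+ n ⟧    = n ×′ 1#
      ⟦ -[1+ n ] ⟧ = - (suc n ×′ 1#)

      ⟦-⟧ : ∀ i → ⟦ ℤ.- i ⟧ ≈ - ⟦ i ⟧
      ⟦-⟧ (ℤ.+ zero)  = sym -0#≈0#
      ⟦-⟧ (ℤ.+ suc n) = refl
      ⟦-⟧ -[1+ n ]    = sym (-‿involutive _)

      cancel : ∀ x y z → x - y ≈ (z + x) - (z + y)
      cancel x y z = begin-equality
        x - y                ≈⟨ +-identityˡ _ ⟨
        0# + (x - y)         ≈⟨ +-congʳ (-‿inverseʳ z) ⟨
        z - z + (x - y)      ≈⟨ +-assoc z (- z) (x - y) ⟩
        z + (- z + (x - y))  ≈⟨ +-congˡ (+-assoc (- z) x (- y)) ⟨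
        z + (- z + x - y)    ≈⟨ +-congˡ (+-congʳ (+-comm (- z) x)) ⟩
        z + (x - z - y)      ≈⟨ +-congˡ (+-assoc x (- z) (- y)) ⟩
        z + (x + (- z - y))  ≈⟨ +-assoc z x _ ⟨
        z + x + (- z - y)    ≈⟨ +-congˡ (-‿+-comm z y) ⟩
        z + x - (z + y)      ∎

      ⟦⊖⟧ : ∀ m n → ⟦ m ℤ.⊖ n ⟧ ≈ m ×′ 1# - n ×′ 1#
      ⟦⊖⟧ zero    zero    = sym (-‿inverseʳ 0#)
      ⟦⊖⟧ zero    (suc n) = sym (+-identityˡ _)
      ⟦⊖⟧ (suc m) zero    = sym (trans (+-congˡ -0#≈0#) (+-identityʳ _))
      ⟦⊖⟧ (suc m) (suc n) = begin-equality
        ⟦ suc m ℤ.⊖ suc n ⟧              ≡⟨ ≡.cong ⟦_⟧ (ℤ.[1+m]⊖[1+n]≡m⊖n m n) ⟩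
        ⟦ m ℤ.⊖ n ⟧                      ≈⟨ ⟦⊖⟧ m n ⟩
        m ×′ 1# - n ×′ 1#                ≈⟨ cancel _ _ 1# ⟩
        1# + m ×′ 1# - (1# + n ×′ 1#)    ≈⟨ +-cong (1+× m 1#) (-‿cong (1+× n 1#)) ⟨
        suc m ×′ 1# - suc n ×′ 1#        ∎

      ⟦+⟧ : ∀ i j → ⟦ i ℤ.+ j ⟧ ≈ ⟦ i ⟧ + ⟦ j ⟧
      ⟦+⟧ (ℤ.+ m)  (ℤ.+ n)  = ×′-homo-+ 1# m n
      ⟦+⟧ (ℤ.+ m)  -[1+ n ] = ⟦⊖⟧ m (suc n)
      ⟦+⟧ -[1+ m ] (ℤ.+ n)  = trans (⟦⊖⟧ n (suc m)) (+-comm _ _)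
      ⟦+⟧ -[1+ m ] -[1+ n ] = begin-equality
        - (suc (suc (m ℕ.+ n)) ×′ 1#)        ≡⟨ ≡.cong (λ k → - (k ×′ 1#)) (ℕ.+-suc (suc m) n) ⟨
        - ((suc m ℕ.+ suc n) ×′ 1#)          ≈⟨ -‿cong (×′-homo-+ 1# (suc m) (suc n)) ⟩
        - (suc m ×′ 1# + suc n ×′ 1#)        ≈⟨ -‿+-comm _ _ ⟨
        - (suc m ×′ 1#) - suc n ×′ 1#        ∎

      ⟦pos*⟧ : ∀ m j → ⟦ ℤ.+ m ℤ.* j ⟧ ≈ ⟦ ℤ.+ m ⟧ * ⟦ j ⟧
      ⟦pos*⟧ m (ℤ.+ n) = begin-equality
        ⟦ ℤ.+ m ℤ.* ℤ.+ n ⟧     ≡⟨ ≡.cong ⟦_⟧ (ℤ.pos-* m n) ⟨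
        (m ℕ.* n) ×′ 1#         ≈⟨ ×′1-homo-* m n ⟩
        m ×′ 1# * n ×′ 1#       ∎
      ⟦pos*⟧ m -[1+ n ] = begin-equality
        ⟦ ℤ.+ m ℤ.* (ℤ.- ℤ.+ suc n) ⟧      ≡⟨ ≡.cong ⟦_⟧ (ℤ.neg-distribʳ-* (ℤ.+ m) (ℤ.+ suc n)) ⟨
        ⟦ ℤ.- (ℤ.+ m ℤ.* ℤ.+ suc n) ⟧      ≈⟨ ⟦-⟧ (ℤ.+ m ℤ.* ℤ.+ suc n) ⟩
        - ⟦ ℤ.+ m ℤ.* ℤ.+ suc n ⟧          ≈⟨ -‿cong (⟦pos*⟧ m (ℤ.+ suc n)) ⟩
        - (m ×′ 1# * suc n ×′ 1#)          ≈⟨ -‿cong (*-comm _ _) ⟩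
        - (suc n ×′ 1# * m ×′ 1#)          ≈⟨ -‿distribˡ-* _ _ ⟩
        - (suc n ×′ 1#) * m ×′ 1#          ≈⟨ *-comm _ _ ⟩
        m ×′ 1# * - (suc n ×′ 1#)          ∎

      ⟦*⟧ : ∀ i j → ⟦ i ℤ.* j ⟧ ≈ ⟦ i ⟧ * ⟦ j ⟧
      ⟦*⟧ (ℤ.+ m)  j = ⟦pos*⟧ m j
      ⟦*⟧ -[1+ m ] j = begin-equality
        ⟦ (ℤ.- ℤ.+ suc m) ℤ.* j ⟧    ≡⟨ ≡.cong ⟦_⟧ (ℤ.neg-distribˡ-* (ℤ.+ suc m) j) ⟨
        ⟦ ℤ.- (ℤ.+ suc m ℤ.* j) ⟧    ≈⟨ ⟦-⟧ (ℤ.+ suc m ℤ.* j) ⟩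
        - ⟦ ℤ.+ suc m ℤ.* j ⟧        ≈⟨ -‿cong (⟦pos*⟧ (suc m) j) ⟩
        - (suc m ×′ 1# * ⟦ j ⟧)      ≈⟨ -‿distribˡ-* _ _ ⟩
        - (suc m ×′ 1#) * ⟦ j ⟧      ∎

      homomorphism : ℤ.+-*-rawRing -Raw-AlmostCommutative⟶ fromCommutativeRing commutativeRing
      homomorphism = record
        { ⟦_⟧    = ⟦_⟧
        ; +-homo = ⟦+⟧
        ; *-homo = ⟦*⟧
        ; -‿homo = ⟦-⟧
        ; 0-homo = refl
        ; 1-homo = refl
        }

      _coeff≟_ : ∀ i j → Maybe (⟦ i ⟧ ≈ ⟦ j ⟧)
      i coeff≟ j with i ℤ.≟ j
      ... | yes ≡.refl = just refl
      ... | no  _      = nothing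

    open RingSolver ℤ.+-*-rawRing (fromCommutativeRing commutativeRing)
      ℤ-solver.homomorphism ℤ-solver._coeff≟_ public
      using (solve; _:=_; _:+_; _:*_; _:-_; :-_; con; Polynomial)

    pattern :0 = con (ℤ.+ 0)
    pattern :1 = con (ℤ.+ 1)

    private variable w x y z : ℝ

    ≰⇒> : ¬ (x ≤ y) → y < x
    ≰⇒> = NonStrictToStrict.≰⇒> _≈_ _≤_ sym ≤-reflexive total

    <⇒≱ : x < y → ¬ (y ≤ x)
    <⇒≱ = NonStrictToStrict.<⇒≱ _≈_ _≤_ antisym

    ≮⇒≥ : ¬ (x < y) → y ≤ x
    ≮⇒≥ = NonStrictToStrict.≮⇒≥ _≈_ _≤_ sym (λ x y → em) ≤-reflexive total

    ≤-by : ∀ {x y} w → 0# ≤ w → y ≈ x + w → x ≤ y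
    ≤-by {x} {y} w 0≤w y≈x+w = begin
      x       ≈⟨ +-identityˡ x ⟨
      0# + x  ≤⟨ +-monoˡ-≤ x 0≤w ⟩
      w + x   ≈⟨ +-comm w x ⟩
      x + w   ≈⟨ y≈x+w ⟨
      y       ∎

    +-mono-≤ : w ≤ x → y ≤ z → w + y ≤ x + z
    +-mono-≤ {w} {x} {y} {z} w≤x y≤z = begin
      w + y  ≤⟨ +-monoˡ-≤ y w≤x ⟩
      x + y  ≈⟨ +-comm x y ⟩
      y + x  ≤⟨ +-monoˡ-≤ x y≤z ⟩
      z + x  ≈⟨ +-comm z x ⟩
      x + z  ∎

    +-nonneg : 0# ≤ x → 0# ≤ y → 0# ≤ x + y
    +-nonneg {x} {y} 0≤x 0≤y = ≤-trans (≤-reflexive (sym (+-identityˡ 0#))) (+-mono-≤ 0≤x 0≤y)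

    x≤y⇒0≤y-x : x ≤ y → 0# ≤ y - x
    x≤y⇒0≤y-x {x} {y} x≤y = ≤-trans (≤-reflexive (sym (-‿inverseʳ x))) (+-monoˡ-≤ (- x) x≤y)

    0≤y-x⇒x≤y : 0# ≤ y - x → x ≤ y
    0≤y-x⇒x≤y {y} {x} 0≤y-x = ≤-by (y - x) 0≤y-x
      (solve 2 (λ x y → y := x :+ (y :- x)) refl x y)

    +-cancelʳ-≤ : ∀ z {x y} → x + z ≤ y + z → x ≤ y
    +-cancelʳ-≤ z {x} {y} x+z≤y+z = ≤-by (y + z - (x + z)) (x≤y⇒0≤y-x x+z≤y+z)
      (solve 3 (λ x y z → y := x :+ (y :+ z :- (x :+ z))) refl x y z)

    neg-mono-≤ : x ≤ y → - y ≤ - x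
    neg-mono-≤ {x} {y} x≤y = ≤-by (y - x) (x≤y⇒0≤y-x x≤y)
      (solve 2 (λ x y → :- x := :- y :+ (y :- x)) refl x y)

    *-monoˡ-≤ : 0# ≤ z → x ≤ y → z * x ≤ z * y
    *-monoˡ-≤ {z} {x} {y} 0≤z x≤y = ≤-by (z * (y - x)) (*-nonneg 0≤z (x≤y⇒0≤y-x x≤y))
      (solve 3 (λ x y z → z :* y := z :* x :+ z :* (y :- x)) refl x y z)

    *-monoʳ-≤ : 0# ≤ z → x ≤ y → x * z ≤ y * z
    *-monoʳ-≤ {z} {x} {y} 0≤z x≤y = begin
      x * z  ≈⟨ *-comm x z ⟩
      z * x  ≤⟨ *-monoˡ-≤ 0≤z x≤y ⟩
      z * y  ≈⟨ *-comm z y ⟩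
      y * z  ∎

    *-mono-≤ : 0# ≤ w → 0# ≤ y → w ≤ x → y ≤ z → w * y ≤ x * z
    *-mono-≤ 0≤w 0≤y w≤x y≤z = ≤-trans (*-monoʳ-≤ 0≤y w≤x) (*-monoˡ-≤ (≤-trans 0≤w w≤x) y≤z)

    0≤1 : 0# ≤ 1#
    0≤1 with total 0# 1#
    ... | inj₁ 0≤1 = 0≤1
    ... | inj₂ 1≤0 = ≤-trans (*-nonneg 0≤-1 0≤-1)
      (≤-reflexive (solve 0 (:- :1 :* :- :1 := :1) refl))
      where
      0≤-1 : 0# ≤ - 1#
      0≤-1 = ≤-trans (x≤y⇒0≤y-x 1≤0) (≤-reflexive (+-identityˡ _))

    0<1 : 0# < 1#
    0<1 = 0≤1 , 0≉1

    <⇒≉˘ : 0# < x → ¬ (x ≈ 0#)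
    <⇒≉˘ (_ , 0≉x) x≈0 = 0≉x (sym x≈0)

    <-≤-trans : x < y → y ≤ z → x < z
    <-≤-trans x<y y≤z = ≰⇒> λ z≤x → <⇒≱ x<y (≤-trans y≤z z≤x)

    ≤-<-trans : x ≤ y → y < z → x < z
    ≤-<-trans x≤y y<z = ≰⇒> λ z≤x → <⇒≱ y<z (≤-trans z≤x x≤y)

    x<y⇒0<y-x : x < y → 0# < y - x
    x<y⇒0<y-x x<y = ≰⇒> λ y-x≤0 → <⇒≱ x<y
      (0≤y-x⇒x≤y (≤-trans (x≤y⇒0≤y-x y-x≤0) (≤-reflexive (solve 2 (λ x y → :0 :- (y :- x) := x :- y) refl _ _))))

    x⁻¹*x≈1 : 0# < x → x ⁻¹ * x ≈ 1#
    x⁻¹*x≈1 0<x = trans (*-comm _ _) (*-inverseʳ (<⇒≉˘ 0<x))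

    x⁻¹-pos : 0# < x → 0# < x ⁻¹
    x⁻¹-pos {x} 0<x = ≰⇒> λ x⁻¹≤0 → <⇒≱ 0<1 (begin
      1#        ≈⟨ *-inverseʳ (<⇒≉˘ 0<x) ⟨
      x * x ⁻¹  ≤⟨ *-monoˡ-≤ (proj₁ 0<x) x⁻¹≤0 ⟩
      x * 0#    ≈⟨ zeroʳ x ⟩
      0#        ∎)

    *-cancelˡ-≤ : ∀ {z x y} → 0# < z → z * x ≤ z * y → x ≤ y
    *-cancelˡ-≤ {z} {x} {y} 0<z zx≤zy = begin
      x               ≈⟨ undo x ⟩
      z ⁻¹ * (z * x)  ≤⟨ *-monoˡ-≤ (proj₁ (x⁻¹-pos 0<z)) zx≤zy ⟩
      z ⁻¹ * (z * y)  ≈⟨ undo y ⟨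
      y               ∎
      where
      undo : ∀ u → u ≈ z ⁻¹ * (z * u)
      undo u = begin-equality
        u               ≈⟨ *-identityˡ u ⟨
        1# * u          ≈⟨ *-congʳ (x⁻¹*x≈1 0<z) ⟨
        z ⁻¹ * z * u    ≈⟨ *-assoc _ _ _ ⟩
        z ⁻¹ * (z * u)  ∎

    *-pos : 0# < x → 0# < y → 0# < x * y
    *-pos {x} {y} 0<x 0<y = ≰⇒> λ xy≤0 → <⇒≱ 0<y (*-cancelˡ-≤ 0<x (≤-trans xy≤0 (≤-reflexive (sym (zeroʳ x)))))

    +-pos-nonneg : 0# < x → 0# ≤ y → 0# < x + y
    +-pos-nonneg {x} {y} 0<x 0≤y = <-≤-trans 0<x (≤-by y 0≤y refl)

    x/y*y≈x : 0# < y → x / y * y ≈ x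
    x/y*y≈x {y} {x} 0<y = begin-equality
      x * y ⁻¹ * y    ≈⟨ *-assoc _ _ _ ⟩
      x * (y ⁻¹ * y)  ≈⟨ *-congˡ (x⁻¹*x≈1 0<y) ⟩
      x * 1#          ≈⟨ *-identityʳ x ⟩
      x               ∎

    /-pos : 0# < x → 0# < y → 0# < x / y
    /-pos 0<x 0<y = *-pos 0<x (x⁻¹-pos 0<y)

    /-nonneg : 0# ≤ x → 0# < y → 0# ≤ x / y
    /-nonneg 0≤x 0<y = *-nonneg 0≤x (proj₁ (x⁻¹-pos 0<y))

    x≤∣x∣ : ∀ x → x ≤ ∣ x ∣
    x≤∣x∣ x = NaturalChoiceMaxOp.x≤x⊔y (NaturalChoiceMax.maxOperator totalOrder) x (- x)

    -x≤∣x∣ : ∀ x → - x ≤ ∣ x ∣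
    -x≤∣x∣ x = NaturalChoiceMaxOp.x≤y⊔x (NaturalChoiceMax.maxOperator totalOrder) x (- x)

    ∣x∣≤ : x ≤ y → - x ≤ y → ∣ x ∣ ≤ y
    ∣x∣≤ {x} {y} x≤y -x≤y = NaturalChoiceMaxOp.⊔-lub (NaturalChoiceMax.maxOperator totalOrder) x≤y -x≤y

    0≤fromℕ : ∀ n → 0# ≤ fromℕ n
    0≤fromℕ zero    = ≤-refl
    0≤fromℕ (suc n) = +-nonneg 0≤1 (0≤fromℕ n)

    0<fromℕ : ∀ n .{{_ : ℕ.NonZero n}} → 0# < fromℕ n
    0<fromℕ (suc n) = +-pos-nonneg 0<1 (0≤fromℕ n)

    fromℕ-+ : ∀ m n → fromℕ (m ℕ.+ n) ≈ fromℕ m + fromℕ n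
    fromℕ-+ = ×-homo-+ 1#

    fromℕ-* : ∀ m n → fromℕ (m ℕ.* n) ≈ fromℕ m * fromℕ n
    fromℕ-* = ×1-homo-*

    fromℕ-mono-≤ : ∀ {m n} → m ℕ.≤ n → fromℕ m ≤ fromℕ n
    fromℕ-mono-≤ {m} {n} m≤n = ≤-by (fromℕ (n ℕ.∸ m)) (0≤fromℕ (n ℕ.∸ m))
      (trans (reflexive (≡.cong fromℕ (≡.sym (ℕ.m+[n∸m]≡n m≤n)))) (fromℕ-+ m (n ℕ.∸ m)))

    fromℕ-cancel-< : ∀ {m n} → fromℕ m < fromℕ n → m ℕ.< n
    fromℕ-cancel-< m<n = ℕ.≰⇒> λ n≤m → <⇒≱ m<n (fromℕ-mono-≤ n≤m)

    ^-nonneg : 0# ≤ x → ∀ n → 0# ≤ x ^ n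
    ^-nonneg 0≤x zero    = 0≤1
    ^-nonneg 0≤x (suc n) = *-nonneg 0≤x (^-nonneg 0≤x n)

    ^-mono-≤ : 0# ≤ x → x ≤ y → ∀ n → x ^ n ≤ y ^ n
    ^-mono-≤ 0≤x x≤y zero    = ≤-refl
    ^-mono-≤ 0≤x x≤y (suc n) = *-mono-≤ 0≤x (^-nonneg 0≤x n) x≤y (^-mono-≤ 0≤x x≤y n)

    1≤x⇒1≤x^n : 1# ≤ x → ∀ n → 1# ≤ x ^ n
    1≤x⇒1≤x^n 1≤x zero    = ≤-refl
    1≤x⇒1≤x^n 1≤x (suc n) = ≤-trans (≤-reflexive (sym (*-identityˡ 1#)))
      (*-mono-≤ 0≤1 0≤1 1≤x (1≤x⇒1≤x^n 1≤x n))

    ^-mono-exponent : 1# ≤ x → ∀ {m n} → m ℕ.≤ n → x ^ m ≤ x ^ n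
    ^-mono-exponent 1≤x {n = n} z≤n = 1≤x⇒1≤x^n 1≤x n
    ^-mono-exponent 1≤x (s≤s m≤n)   = *-monoˡ-≤ (≤-trans 0≤1 1≤x) (^-mono-exponent 1≤x m≤n)

    ^-antimono-exponent : 0# ≤ x → x ≤ 1# → ∀ {m n} → m ℕ.≤ n → x ^ n ≤ x ^ m
    ^-antimono-exponent {x} 0≤x x≤1 {n = zero}  z≤n = ≤-refl
    ^-antimono-exponent {x} 0≤x x≤1 {n = suc n} z≤n = begin
      x * x ^ n  ≤⟨ *-mono-≤ 0≤x (^-nonneg 0≤x n) x≤1 (^-antimono-exponent 0≤x x≤1 {n = n} z≤n) ⟩
      1# * 1#    ≈⟨ *-identityˡ 1# ⟩
      1#         ∎
    ^-antimono-exponent 0≤x x≤1 (s≤s m≤n) = *-monoˡ-≤ 0≤x (^-antimono-exponent 0≤x x≤1 m≤n)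

    abstract
      -- If no multiple of y exceeds x, the multiples have a supremum s. Adding y to a multiple
      -- gives a multiple, so s - y is an upper bound too, and it is smaller than s.
      archimedean : 0# < y → ∀ x → ∃ λ n → x < fromℕ n * y
      archimedean {y} 0<y x with em {∃ λ n → x < fromℕ n * y}
      ... | yes found = found
      ... | no  none  = contradiction s≤s-y (<⇒≱ s-y<s)
        where
        Multiple : Pred ℝ 0ℓ
        Multiple z = ∃ λ n → z ≈ fromℕ n * y

        bounded : ∀ n → fromℕ n * y ≤ x
        bounded n = ≮⇒≥ λ x<ny → none (n , x<ny)

        sup : ∃ λ s → UpperBound Multiple s × (∀ b → UpperBound Multiple b → s ≤ b)
        sup = supremum Multiple (_ , 0 , refl) (x , λ { z (n , z≈ny) → ≤-trans (≤-reflexive z≈ny) (bounded n) })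

        s : ℝ
        s = proj₁ sup

        s≤s-y : s ≤ s - y
        s≤s-y = proj₂ (proj₂ sup) (s - y) λ { z (n , z≈ny) → begin
          z                      ≈⟨ solve 2 (λ y z → z := (y :+ z) :- y) refl y z ⟩
          y + z - y              ≈⟨ +-congʳ (+-congˡ z≈ny) ⟩
          y + fromℕ n * y - y    ≤⟨ +-monoˡ-≤ (- y) (proj₁ (proj₂ sup) _ (suc n ,
                                     solve 2 (λ a y → y :+ a :* y := (:1 :+ a) :* y) refl (fromℕ n) y)) ⟩
          s - y                  ∎ }

        s-y<s : s - y < s
        s-y<s = ≰⇒> λ s≤s-y → <⇒≱ 0<y (begin
          y            ≤⟨ ≤-by (s - y - s) (x≤y⇒0≤y-x s≤s-y) (solve 2 (λ s y → :0 := y :+ (s :- y :- s)) refl s y) ⟩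
          0#           ∎)

    least : ∀ (P : ℕ → Set) → ∀ n → P n → ∃ λ k → P k × (∀ j → j ℕ.< k → ¬ P j)
    least P zero    p = 0 , p , λ _ ()
    least P (suc n) p with em {P 0}
    ... | yes p₀ = 0 , p₀ , λ _ ()
    ... | no ¬p₀ with least (λ k → P (suc k)) n p
    ...   | k , pk , below = suc k , pk , λ { zero _ → ¬p₀ ; (suc j) (s≤s j<k) → below j j<k }

    abstract
      floor : 0# < y → 0# ≤ x → ∃ λ n → fromℕ n * y ≤ x × x < fromℕ (suc n) * y
      floor {y} {x} 0<y 0≤x with archimedean 0<y x
      ... | N , x<Ny with least (λ n → x < fromℕ n * y) N x<Ny
      ...   | zero  , x<0y , _     = contradiction 0≤x (<⇒≱ (<-≤-trans x<0y (≤-reflexive (zeroˡ y))))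
      ...   | suc k , x<ky , below = k , ≮⇒≥ (below k (ℕ.n<1+n k)) , x<ky

  open OrderedField

  -- The exponential series, its functional equation and its inverse.

  module Exponential where

    open SemiringSum semiring using (sum-cong-≋; ∑-distrib-+; *-distribˡ-sum)

    private variable x y z : ℝ

    *-cancelˡ-≈ : 0# < z → z * x ≈ z * y → x ≈ y
    *-cancelˡ-≈ 0<z zx≈zy =
      antisym (*-cancelˡ-≤ 0<z (≤-reflexive zx≈zy)) (*-cancelˡ-≤ 0<z (≤-reflexive (sym zx≈zy)))

    module _ {s t : ℕ → ℝ} where

      ∑-cong : (∀ i → s i ≈ t i) → ∀ n → ∑[i< n ] s ≈ ∑[i< n ] t
      ∑-cong s≈t n = sum-cong-≋ {n} (λ i → s≈t (toℕ i))

      ∑-+ : ∀ n → ∑[i< n ] (λ i → s i + t i) ≈ ∑[i< n ] s + ∑[i< n ] t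
      ∑-+ n = ∑-distrib-+ {n} (λ i → s (toℕ i)) (λ i → t (toℕ i))

    ∑-*ˡ : ∀ c s n → ∑[i< n ] (λ i → c * s i) ≈ c * ∑[i< n ] s
    ∑-*ˡ c s n = sym (*-distribˡ-sum {n} c (λ i → s (toℕ i)))

    ∑-mono-≤ : ∀ {s t : ℕ → ℝ} → (∀ i → s i ≤ t i) → ∀ n → ∑[i< n ] s ≤ ∑[i< n ] t
    ∑-mono-≤ s≤t zero    = ≤-refl
    ∑-mono-≤ s≤t (suc n) = +-mono-≤ (s≤t 0) (∑-mono-≤ (s≤t ∘ suc) n)

    ∑-nonneg : ∀ {s : ℕ → ℝ} → (∀ i → 0# ≤ s i) → ∀ n → 0# ≤ ∑[i< n ] s
    ∑-nonneg 0≤s zero    = ≤-refl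
    ∑-nonneg 0≤s (suc n) = +-nonneg (0≤s 0) (∑-nonneg (0≤s ∘ suc) n)

    ∑-mono-length : ∀ {s : ℕ → ℝ} → (∀ i → 0# ≤ s i) →
                    ∀ {m n} → m ℕ.≤ n → ∑[i< m ] s ≤ ∑[i< n ] s
    ∑-mono-length 0≤s {n = n} z≤n = ∑-nonneg 0≤s n
    ∑-mono-length 0≤s (s≤s m≤n)   = +-mono-≤ ≤-refl (∑-mono-length (0≤s ∘ suc) m≤n)

    -- The Cauchy product of two coefficient sequences. Recursion on the first sequence turns its
    -- laws into inductions on n with that sequence generalised.
    conv : (ℕ → ℝ) → (ℕ → ℝ) → ℕ → ℝ
    conv a b zero    = a 0 * b 0
    conv a b (suc n) = a 0 * b (suc n) + conv (a ∘ suc) b n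

    conv-cong : ∀ {a a′ b b′ : ℕ → ℝ} → (∀ i → a i ≈ a′ i) → (∀ i → b i ≈ b′ i) →
                ∀ n → conv a b n ≈ conv a′ b′ n
    conv-cong a≈a′ b≈b′ zero    = *-cong (a≈a′ 0) (b≈b′ 0)
    conv-cong a≈a′ b≈b′ (suc n) =
      +-cong (*-cong (a≈a′ 0) (b≈b′ (suc n))) (conv-cong (a≈a′ ∘ suc) b≈b′ n)

    conv-+ˡ : ∀ (a a′ b : ℕ → ℝ) n →
              conv (λ i → a i + a′ i) b n ≈ conv a b n + conv a′ b n
    conv-+ˡ a a′ b zero    = distribʳ _ _ _
    conv-+ˡ a a′ b (suc n) = trans (+-congˡ (conv-+ˡ (a ∘ suc) (a′ ∘ suc) b n))
      (solve 5 (λ a a′ b c c′ → (a :+ a′) :* b :+ (c :+ c′) := a :* b :+ c :+ (a′ :* b :+ c′)) refl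
        (a 0) (a′ 0) (b (suc n)) (conv (a ∘ suc) b n) (conv (a′ ∘ suc) b n))

    conv-+ʳ : ∀ (a b b′ : ℕ → ℝ) n →
              conv a (λ i → b i + b′ i) n ≈ conv a b n + conv a b′ n
    conv-+ʳ a b b′ zero    = distribˡ _ _ _
    conv-+ʳ a b b′ (suc n) = trans (+-congˡ (conv-+ʳ (a ∘ suc) b b′ n))
      (solve 5 (λ a b b′ c c′ → a :* (b :+ b′) :+ (c :+ c′) := a :* b :+ c :+ (a :* b′ :+ c′)) refl
        (a 0) (b (suc n)) (b′ (suc n)) (conv (a ∘ suc) b n) (conv (a ∘ suc) b′ n))

    conv-*ˡ : ∀ c (a b : ℕ → ℝ) n → conv (λ i → c * a i) b n ≈ c * conv a b n
    conv-*ˡ c a b zero    = *-assoc _ _ _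
    conv-*ˡ c a b (suc n) = trans (+-congˡ (conv-*ˡ c (a ∘ suc) b n))
      (solve 4 (λ c a b d → c :* a :* b :+ c :* d := c :* (a :* b :+ d)) refl
        c (a 0) (b (suc n)) (conv (a ∘ suc) b n))

    conv-*ʳ : ∀ c (a b : ℕ → ℝ) n → conv a (λ i → c * b i) n ≈ c * conv a b n
    conv-*ʳ c a b zero    = solve 3 (λ c a b → a :* (c :* b) := c :* (a :* b)) refl c (a 0) (b 0)
    conv-*ʳ c a b (suc n) = trans (+-congˡ (conv-*ʳ c (a ∘ suc) b n))
      (solve 4 (λ c a b d → a :* (c :* b) :+ c :* d := c :* (a :* b :+ d)) refl
        c (a 0) (b (suc n)) (conv (a ∘ suc) b n))

    conv-nonneg : ∀ {a b : ℕ → ℝ} → (∀ i → 0# ≤ a i) → (∀ i → 0# ≤ b i) → ∀ n → 0# ≤ conv a b n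
    conv-nonneg 0≤a 0≤b zero    = *-nonneg (0≤a 0) (0≤b 0)
    conv-nonneg 0≤a 0≤b (suc n) = +-nonneg (*-nonneg (0≤a 0) (0≤b (suc n))) (conv-nonneg (0≤a ∘ suc) 0≤b n)

    derivative : (ℕ → ℝ) → ℕ → ℝ
    derivative a i = fromℕ (suc i) * a (suc i)

    -- The product rule for formal power series. It takes the place of the binomial theorem: by it,
    -- both sides of `conv-expTerm` satisfy the same first-order recursion in n.
    leibniz : ∀ a b n → fromℕ (suc n) * conv a b (suc n) ≈
                        conv (derivative a) b n + conv a (derivative b) n
    leibniz a b zero = solve 5
      (λ o a₀ a₁ b₀ b₁ → o :* (a₀ :* b₁ :+ a₁ :* b₀) := o :* a₁ :* b₀ :+ a₀ :* (o :* b₁)) refl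
      (fromℕ 1) (a 0) (a 1) (b 0) (b 1)
    leibniz a b (suc n) = begin-equality
      (1# + k) * (a₀ * b₂ + (a₁ * b₁ + c))
        ≈⟨ solve 6 (λ k a₀ a₁ b₁ b₂ c →
             (:1 :+ k) :* (a₀ :* b₂ :+ (a₁ :* b₁ :+ c)) :=
             a₁ :* b₁ :+ c :+ a₀ :* ((:1 :+ k) :* b₂) :+ k :* (a₁ :* b₁ :+ c)) refl k a₀ a₁ b₁ b₂ c ⟩
      a₁ * b₁ + c + a₀ * ((1# + k) * b₂) + k * conv (a ∘ suc) b (suc n)
        ≈⟨ +-congˡ (leibniz (a ∘ suc) b n) ⟩
      a₁ * b₁ + c + a₀ * ((1# + k) * b₂) + (p + q)
        ≈⟨ solve 7 (λ a₀ a₁ b₁ db₁ c p q →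
             a₁ :* b₁ :+ c :+ a₀ :* db₁ :+ (p :+ q) :=
             (:1 :+ :0) :* a₁ :* b₁ :+ (c :+ p) :+ (a₀ :* db₁ :+ q)) refl a₀ a₁ b₁ ((1# + k) * b₂) c p q ⟩
      fromℕ 1 * a₁ * b₁ + (c + p) + (a₀ * ((1# + k) * b₂) + q)
        ≈⟨ +-congʳ (+-congˡ (conv-+ˡ (a ∘ ℕ.suc ∘ ℕ.suc) (derivative (a ∘ suc)) b n)) ⟨
      fromℕ 1 * a₁ * b₁ + conv (λ i → a (suc (suc i)) + derivative (a ∘ suc) i) b n + (a₀ * ((1# + k) * b₂) + q)
        ≈⟨ +-congʳ (+-congˡ (conv-cong
             (λ i → solve 2 (λ k a → a :+ k :* a := (:1 :+ k) :* a) refl (fromℕ (suc i)) (a (suc (suc i))))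
             (λ _ → refl) n)) ⟩
      conv (derivative a) b (suc n) + conv a (derivative b) (suc n) ∎
      where
      k  = fromℕ (suc n)
      a₀ = a 0
      a₁ = a 1
      b₁ = b (suc n)
      b₂ = b (suc (suc n))
      c  = conv (a ∘ ℕ.suc ∘ ℕ.suc) b n
      p  = conv (derivative (a ∘ suc)) b n
      q  = conv (a ∘ suc) (derivative b) n

    ∑-conv-suc : ∀ a b n → ∑[i< suc n ] conv a b ≈
                           a 0 * ∑[i< suc n ] b + ∑[i< n ] conv (a ∘ suc) b
    ∑-conv-suc a b n = begin-equality
      a 0 * b 0 + ∑[i< n ] (λ i → a 0 * b (suc i) + conv (a ∘ suc) b i)
        ≈⟨ +-congˡ (∑-+ {λ i → a 0 * b (suc i)} {conv (a ∘ suc) b} n) ⟩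
      a 0 * b 0 + (∑[i< n ] (λ i → a 0 * b (suc i)) + ∑[i< n ] conv (a ∘ suc) b)
        ≈⟨ +-congˡ (+-congʳ (∑-*ˡ (a 0) (b ∘ suc) n)) ⟩
      a 0 * b 0 + (a 0 * ∑[i< n ] (b ∘ suc) + ∑[i< n ] conv (a ∘ suc) b)
        ≈⟨ solve 4 (λ a b s t → a :* b :+ (a :* s :+ t) := a :* (b :+ s) :+ t) refl
             (a 0) (b 0) (∑[i< n ] (b ∘ suc)) (∑[i< n ] conv (a ∘ suc) b) ⟩
      a 0 * ∑[i< suc n ] b + ∑[i< n ] conv (a ∘ suc) b ∎

    -- The triangle i + j < n lies inside the square i, j < n.
    ∑-conv-≤ : ∀ {a b : ℕ → ℝ} → (∀ i → 0# ≤ a i) → (∀ i → 0# ≤ b i) →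
               ∀ n → ∑[i< n ] conv a b ≤ ∑[i< n ] a * ∑[i< n ] b
    ∑-conv-≤ 0≤a 0≤b zero = ≤-reflexive (sym (zeroˡ 0#))
    ∑-conv-≤ {a} {b} 0≤a 0≤b (suc n) = begin
      ∑[i< suc n ] conv a b
        ≈⟨ ∑-conv-suc a b n ⟩
      a 0 * ∑[i< suc n ] b + ∑[i< n ] conv (a ∘ suc) b
        ≤⟨ +-mono-≤ ≤-refl (∑-conv-≤ (0≤a ∘ suc) 0≤b n) ⟩
      a 0 * ∑[i< suc n ] b + ∑[i< n ] (a ∘ suc) * ∑[i< n ] b
        ≤⟨ +-mono-≤ ≤-refl (*-monoˡ-≤ (∑-nonneg (0≤a ∘ suc) n) (∑-mono-length 0≤b (ℕ.n≤1+n n))) ⟩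
      a 0 * ∑[i< suc n ] b + ∑[i< n ] (a ∘ suc) * ∑[i< suc n ] b
        ≈⟨ distribʳ _ _ _ ⟨
      ∑[i< suc n ] a * ∑[i< suc n ] b ∎

    -- The rectangle i < n, j < m lies inside the triangle i + j < n + m.
    ≤-∑-conv : ∀ {a b : ℕ → ℝ} → (∀ i → 0# ≤ a i) → (∀ i → 0# ≤ b i) →
               ∀ n m → ∑[i< n ] a * ∑[i< m ] b ≤ ∑[i< n ℕ.+ m ] conv a b
    ≤-∑-conv 0≤a 0≤b zero m = ≤-trans (≤-reflexive (zeroˡ _)) (∑-nonneg (conv-nonneg 0≤a 0≤b) m)
    ≤-∑-conv {a} {b} 0≤a 0≤b (suc n) m = begin
      ∑[i< suc n ] a * ∑[i< m ] b
        ≈⟨ distribʳ _ _ _ ⟩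
      a 0 * ∑[i< m ] b + ∑[i< n ] (a ∘ suc) * ∑[i< m ] b
        ≤⟨ +-mono-≤ (*-monoˡ-≤ (0≤a 0) (∑-mono-length 0≤b (ℕ.m≤n+m m (suc n))))
             (≤-∑-conv (0≤a ∘ suc) 0≤b n m) ⟩
      a 0 * ∑[i< suc (n ℕ.+ m) ] b + ∑[i< n ℕ.+ m ] conv (a ∘ suc) b
        ≈⟨ ∑-conv-suc a b (n ℕ.+ m) ⟨
      ∑[i< suc n ℕ.+ m ] conv a b ∎

    ≤-by-approximation : (∀ η → 0# < η → x ≤ y + η) → x ≤ y
    ≤-by-approximation {x} {y} x≤y+η = ≮⇒≥ λ y<x →
      let 0<d = x<y⇒0<y-x y<x
          two = 0<fromℕ 2
          h   = (x - y) / fromℕ 2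
          0<h = /-pos 0<d two
      in <⇒≱ 0<h (≤-by (y + h - x) (x≤y⇒0≤y-x (x≤y+η h 0<h)) (begin-equality
           0#                              ≈⟨ -‿inverseʳ (h * fromℕ 2) ⟨
           h * fromℕ 2 - h * fromℕ 2       ≈⟨ +-congˡ (-‿cong (x/y*y≈x two)) ⟩
           h * fromℕ 2 - (x - y)           ≈⟨ solve 3 (λ h x y →
                                                h :* (:1 :+ (:1 :+ :0)) :- (x :- y) := h :+ (y :+ h :- x)) refl h x y ⟩
           h + (y + h - x)                 ∎))

    ∣x-y∣≤⇒x≤ : ∀ x y {η} → ∣ x - y ∣ ≤ η → x ≤ y + η
    ∣x-y∣≤⇒x≤ x y {η} close = ≤-by (η - (x - y)) (x≤y⇒0≤y-x (≤-trans (x≤∣x∣ _) close))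
      (solve 3 (λ x y η → y :+ η := x :+ (η :- (x :- y))) refl x y η)

    ∣x-y∣≤⇒y≤ : ∀ x y {η} → ∣ x - y ∣ ≤ η → y ≤ x + η
    ∣x-y∣≤⇒y≤ x y {η} close = ≤-by (η - - (x - y)) (x≤y⇒0≤y-x (≤-trans (-x≤∣x∣ _) close))
      (solve 3 (λ x y η → x :+ η := y :+ (η :- (:- (x :- y)))) refl x y η)

    ⟶-unique-≤ : ∀ {s a b} → s ⟶ a → s ⟶ b → a ≤ b
    ⟶-unique-≤ {s} {a} {b} s⟶a s⟶b = ≤-by-approximation λ η 0<η → ≤-by-approximation λ η′ 0<η′ →
      let M , near-a = s⟶a η′ 0<η′
          N , near-b = s⟶b η 0<η
          n = M ℕ.⊔ N
      in ≤-trans (∣x-y∣≤⇒y≤ (s n) a (near-a n (ℕ.m≤m⊔n M N)))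
           (+-monoˡ-≤ η′ (∣x-y∣≤⇒x≤ (s n) b (near-b n (ℕ.m≤n⊔m M N))))

    lim-unique : ∀ {s l} → s ⟶ l → lim s ≈ l
    lim-unique {s} {l} s⟶l with em {∃ λ l → s ⟶ l}
    ... | yes (l′ , s⟶l′) = antisym (⟶-unique-≤ {s} s⟶l′ s⟶l) (⟶-unique-≤ {s} s⟶l s⟶l′)
    ... | no  diverges    = contradiction (l , s⟶l) diverges

    lim-converges-or-0 : ∀ s → s ⟶ lim s ⊎ lim s ≡ 0#
    lim-converges-or-0 s with em {∃ λ l → s ⟶ l}
    ... | yes (_ , s⟶l) = inj₁ s⟶l
    ... | no  _         = inj₂ ≡.refl

    record IsLUB (s : ℕ → ℝ) (l : ℝ) : Set where
      field
        upper   : ∀ n → s n ≤ l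
        minimal : ∀ b → (∀ n → s n ≤ b) → l ≤ b

      approached : ∀ η → 0# < η → ∃ λ n → l ≤ s n + η
      approached η 0<η with em {∃ λ n → l ≤ s n + η}
      ... | yes found = found
      ... | no  none  = contradiction (minimal (l - η) λ n → ≤-by (l - (s n + η))
              (x≤y⇒0≤y-x (proj₁ (≰⇒> (λ l≤s+η → none (n , l≤s+η)))))
              (solve 3 (λ s l η → l :- η := s :+ (l :- (s :+ η))) refl (s n) l η))
            (λ l≤l-η → <⇒≱ 0<η (≤-by (l - η - l) (x≤y⇒0≤y-x l≤l-η)
              (solve 2 (λ l η → :0 := η :+ (l :- η :- l)) refl l η)))

    open IsLUB public

    monotone-LUB : ∀ {s b} → (∀ {m n} → m ℕ.≤ n → s m ≤ s n) → (∀ n → s n ≤ b) →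
                   ∃ λ l → IsLUB s l × s ⟶ l
    monotone-LUB {s} {b} s-mono s≤b = l , lub , λ η 0<η →
      let N , l≤sN+η = approached lub η 0<η in
      N , λ n N≤n → ∣x∣≤
        (≤-by (l - s n + η) (+-nonneg (x≤y⇒0≤y-x (upper lub n)) (proj₁ 0<η))
          (solve 3 (λ s l η → η := s :- l :+ (l :- s :+ η)) refl (s n) l η))
        (≤-by (s n + η - l) (x≤y⇒0≤y-x (≤-trans l≤sN+η (+-monoˡ-≤ η (s-mono N≤n))))
          (solve 3 (λ s l η → η := :- (s :- l) :+ (s :+ η :- l)) refl (s n) l η))
      where
      Value : Pred ℝ 0ℓ
      Value x = ∃ λ n → x ≈ s n

      sup = supremum Value (s 0 , 0 , refl) (b , λ { x (n , x≈sn) → ≤-trans (≤-reflexive x≈sn) (s≤b n) })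
      l   = proj₁ sup

      lub : IsLUB s l
      lub = record
        { upper   = λ n → proj₁ (proj₂ sup) (s n) (n , refl)
        ; minimal = λ c s≤c → proj₂ (proj₂ sup) c λ { x (n , x≈sn) → ≤-trans (≤-reflexive x≈sn) (s≤c n) }
        }

    expTerm : ℝ → ℕ → ℝ
    expTerm x i = x ^ i / fromℕ (i !)

    expSum : ℝ → ℕ → ℝ
    expSum x n = ∑[i< n ] expTerm x

    0<fromℕ[n!] : ∀ n → 0# < fromℕ (n !)
    0<fromℕ[n!] n = 0<fromℕ (n !) {{n ℕ.!≢0}}

    expTerm-def : ∀ x i → fromℕ (i !) * expTerm x i ≈ x ^ i
    expTerm-def x i = trans (*-comm _ _) (x/y*y≈x (0<fromℕ[n!] i))

    expTerm-cong : x ≈ y → ∀ i → expTerm x i ≈ expTerm y i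
    expTerm-cong {x} {y} x≈y i = *-congʳ (^-congˡ i x≈y)

    expTerm-0 : ∀ x → expTerm x 0 ≈ 1#
    expTerm-0 x = begin-equality
      expTerm x 0            ≈⟨ solve 1 (λ t → t := (:1 :+ :0) :* t) refl (expTerm x 0) ⟩
      fromℕ 1 * expTerm x 0  ≈⟨ expTerm-def x 0 ⟩
      1#                     ∎

    expTerm-derivative : ∀ x i → derivative (expTerm x) i ≈ x * expTerm x i
    expTerm-derivative x i = *-cancelˡ-≈ (0<fromℕ[n!] i) (begin-equality
      fromℕ (i !) * (fromℕ (suc i) * expTerm x (suc i))
        ≈⟨ solve 3 (λ a b t → a :* (b :* t) := b :* a :* t) refl (fromℕ (i !)) (fromℕ (suc i)) (expTerm x (suc i)) ⟩
      fromℕ (suc i) * fromℕ (i !) * expTerm x (suc i)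
        ≈⟨ *-congʳ (fromℕ-* (suc i) (i !)) ⟨
      fromℕ (suc i !) * expTerm x (suc i)
        ≈⟨ expTerm-def x (suc i) ⟩
      x * x ^ i
        ≈⟨ *-congˡ (expTerm-def x i) ⟨
      x * (fromℕ (i !) * expTerm x i)
        ≈⟨ solve 3 (λ a x t → x :* (a :* t) := a :* (x :* t)) refl (fromℕ (i !)) x (expTerm x i) ⟩
      fromℕ (i !) * (x * expTerm x i) ∎)

    conv-expTerm : ∀ x y n → conv (expTerm x) (expTerm y) n ≈ expTerm (x + y) n
    conv-expTerm x y zero = begin-equality
      expTerm x 0 * expTerm y 0  ≈⟨ *-cong (expTerm-0 x) (expTerm-0 y) ⟩
      1# * 1#                    ≈⟨ *-identityˡ 1# ⟩
      1#                         ≈⟨ expTerm-0 (x + y) ⟨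
      expTerm (x + y) 0          ∎
    conv-expTerm x y (suc n) = *-cancelˡ-≈ (0<fromℕ (suc n)) (begin-equality
      fromℕ (suc n) * conv a b (suc n)                   ≈⟨ leibniz a b n ⟩
      conv (derivative a) b n + conv a (derivative b) n  ≈⟨ +-cong
        (conv-cong {b = b} (expTerm-derivative x) (λ _ → refl) n)
        (conv-cong {a = a} (λ _ → refl) (expTerm-derivative y) n) ⟩
      conv (λ i → x * a i) b n + conv a (λ i → y * b i) n
                                                         ≈⟨ +-cong (conv-*ˡ x a b n) (conv-*ʳ y a b n) ⟩
      x * conv a b n + y * conv a b n                    ≈⟨ distribʳ _ _ _ ⟨
      (x + y) * conv a b n                               ≈⟨ *-congˡ (conv-expTerm x y n) ⟩
      (x + y) * expTerm (x + y) n                        ≈⟨ expTerm-derivative (x + y) n ⟨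
      fromℕ (suc n) * expTerm (x + y) (suc n)            ∎)
      where
      a = expTerm x
      b = expTerm y

    expTerm-nonneg : 0# ≤ x → ∀ i → 0# ≤ expTerm x i
    expTerm-nonneg 0≤x i = /-nonneg (^-nonneg 0≤x i) (0<fromℕ[n!] i)

    expSum-mono-≤ : 0# ≤ x → x ≤ y → ∀ n → expSum x n ≤ expSum y n
    expSum-mono-≤ 0≤x x≤y = ∑-mono-≤ λ i → *-monoʳ-≤ (proj₁ (x⁻¹-pos (0<fromℕ[n!] i))) (^-mono-≤ 0≤x x≤y i)

    expSum-mono-length : 0# ≤ x → ∀ {m n} → m ℕ.≤ n → expSum x m ≤ expSum x n
    expSum-mono-length 0≤x = ∑-mono-length (expTerm-nonneg 0≤x)

    expSum-+-≤ : 0# ≤ x → 0# ≤ y → ∀ n → expSum (x + y) n ≤ expSum x n * expSum y n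
    expSum-+-≤ {x} {y} 0≤x 0≤y n = ≤-trans (≤-reflexive (∑-cong (λ i → sym (conv-expTerm x y i)) n))
      (∑-conv-≤ (expTerm-nonneg 0≤x) (expTerm-nonneg 0≤y) n)

    expSum-+-≥ : 0# ≤ x → 0# ≤ y → ∀ n m → expSum x n * expSum y m ≤ expSum (x + y) (n ℕ.+ m)
    expSum-+-≥ {x} {y} 0≤x 0≤y n m = ≤-trans (≤-∑-conv (expTerm-nonneg 0≤x) (expTerm-nonneg 0≤y) n m)
      (≤-reflexive (∑-cong (conv-expTerm x y) (n ℕ.+ m)))

    -- Each term is at most x times its predecessor. In the limit this bounds `exp x * (1# - x)` by
    -- 1, the upper counterpart of `1+x≤exp` from which all later upper estimates are drawn.
    expSum-step : 0# ≤ x → ∀ n → expSum x n ≤ 1# + x * expSum x n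
    expSum-step {x} 0≤x zero    = +-nonneg 0≤1 (*-nonneg 0≤x ≤-refl)
    expSum-step {x} 0≤x (suc n) = begin
      expTerm x 0 + ∑[i< n ] (expTerm x ∘ suc)
        ≤⟨ +-mono-≤ (≤-reflexive (expTerm-0 x)) (∑-mono-≤ term-≤ n) ⟩
      1# + ∑[i< n ] (λ i → x * expTerm x i)
        ≈⟨ +-congˡ (∑-*ˡ x (expTerm x) n) ⟩
      1# + x * expSum x n
        ≤⟨ +-mono-≤ ≤-refl (*-monoˡ-≤ 0≤x (expSum-mono-length 0≤x (ℕ.n≤1+n n))) ⟩
      1# + x * expSum x (suc n) ∎
      where
      term-≤ : ∀ i → expTerm x (suc i) ≤ x * expTerm x i
      term-≤ i = begin
        expTerm x (suc i)                  ≤⟨ ≤-by _ (*-nonneg (0≤fromℕ i) (expTerm-nonneg 0≤x (suc i)))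
                                               (solve 2 (λ k t → (:1 :+ k) :* t := t :+ k :* t) refl (fromℕ i) (expTerm x (suc i))) ⟩
        fromℕ (suc i) * expTerm x (suc i)  ≈⟨ expTerm-derivative x i ⟩
        x * expTerm x i                    ∎

    half : ℝ
    half = 1# / fromℕ 2

    half*2 : half * fromℕ 2 ≈ 1#
    half*2 = x/y*y≈x (0<fromℕ 2)

    0<half : 0# < half
    0<half = /-pos 0<1 (0<fromℕ 2)

    expSum-half : ∀ n → expSum half n ≤ fromℕ 2
    expSum-half n = ≤-by (fromℕ 2 * (1# + half * s - s))
      (*-nonneg (0≤fromℕ 2) (x≤y⇒0≤y-x (expSum-step (proj₁ 0<half) n))) (begin-equality
        fromℕ 2                                         ≈⟨ solve 1 (λ s → con2 := s :+ con2 :* (:1 :- s) :+ :1 :* s) refl s ⟩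
        s + fromℕ 2 * (1# - s) + 1# * s                 ≈⟨ +-congˡ (*-congʳ half*2) ⟨
        s + fromℕ 2 * (1# - s) + half * fromℕ 2 * s     ≈⟨ solve 2 (λ h s → s :+ con2 :* (:1 :- s) :+ h :* con2 :* s
                                                                          := s :+ con2 :* (:1 :+ h :* s :- s)) refl half s ⟩
        s + fromℕ 2 * (1# + half * s - s)               ∎)
      where
      s = expSum half n
      con2 : ∀ {k} → Polynomial k
      con2 = :1 :+ (:1 :+ :0)

    -- Boundedness of the partial sums starts at 1/2, where `expSum-step` reads s ≤ 1 + s / 2, and
    -- spreads to all multiples of 1/2 by `expSum-+-≤`. Every x lies below such a multiple.
    expSum-halves : ∀ k n → expSum (fromℕ k * half) n ≤ fromℕ 2 ^ k
    expSum-halves zero n = begin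
      expSum (0# * half) n                 ≤⟨ expSum-step (≤-reflexive (sym (zeroˡ half))) n ⟩
      1# + 0# * half * expSum (0# * half) n  ≈⟨ solve 2 (λ h s → :1 :+ :0 :* h :* s := :1) refl half (expSum (0# * half) n) ⟩
      1#                                   ∎
    expSum-halves (suc k) n = begin
      expSum (fromℕ (suc k) * half) n          ≈⟨ ∑-cong (expTerm-cong
        (solve 2 (λ k h → (:1 :+ k) :* h := h :+ k :* h) refl (fromℕ k) half)) n ⟩
      expSum (half + fromℕ k * half) n         ≤⟨ expSum-+-≤ (proj₁ 0<half) 0≤kh n ⟩
      expSum half n * expSum (fromℕ k * half) n
        ≤⟨ *-mono-≤ (∑-nonneg (expTerm-nonneg (proj₁ 0<half)) n) (∑-nonneg (expTerm-nonneg 0≤kh) n)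
             (expSum-half n) (expSum-halves k n) ⟩
      fromℕ 2 * fromℕ 2 ^ k                    ∎
      where 0≤kh = *-nonneg (0≤fromℕ k) (proj₁ 0<half)

    -- For nonnegative arguments the partial sums increase, so their limit is a supremum.
    -- Inequalities then pass from partial sums to `exp` without any choice of η and N.
    exp-LUB : 0# ≤ x → IsLUB (expSum x) (exp x)
    exp-LUB {x} 0≤x =
      let k , x<k/2     = archimedean 0<half x
          l , lub , s⟶l = monotone-LUB (expSum-mono-length 0≤x)
                            (λ n → ≤-trans (expSum-mono-≤ 0≤x (proj₁ x<k/2) n) (expSum-halves k n))
          e≈l           = lim-unique {expSum x} s⟶l
      in record { upper   = λ n → ≤-trans (upper lub n) (≤-reflexive (sym e≈l))
                ; minimal = λ b s≤b → ≤-trans (≤-reflexive e≈l) (minimal lub b s≤b) }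

    exp-nonneg : 0# ≤ x → 0# ≤ exp x
    exp-nonneg 0≤x = upper (exp-LUB 0≤x) 0

    expSum-2 : ∀ x → expSum x 2 ≈ 1# + x
    expSum-2 x = +-cong (expTerm-0 x) (begin-equality
      expTerm x 1 + 0#       ≈⟨ solve 1 (λ t → t :+ :0 := (:1 :+ :0) :* t) refl (expTerm x 1) ⟩
      fromℕ 1 * expTerm x 1  ≈⟨ expTerm-derivative x 0 ⟩
      x * expTerm x 0        ≈⟨ *-congˡ (expTerm-0 x) ⟩
      x * 1#                 ≈⟨ *-identityʳ x ⟩
      x                      ∎)

    1+x≤exp : 0# ≤ x → 1# + x ≤ exp x
    1+x≤exp {x} 0≤x = ≤-trans (≤-reflexive (sym (expSum-2 x))) (upper (exp-LUB 0≤x) 2)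

    1≤exp : 0# ≤ x → 1# ≤ exp x
    1≤exp {x} 0≤x = ≤-trans (≤-by x 0≤x refl) (1+x≤exp 0≤x)

    0<exp : 0# ≤ x → 0# < exp x
    0<exp 0≤x = <-≤-trans 0<1 (1≤exp 0≤x)

    exp≤1+x*exp : 0# ≤ x → exp x ≤ 1# + x * exp x
    exp≤1+x*exp {x} 0≤x = minimal (exp-LUB 0≤x) _ λ n →
      ≤-trans (expSum-step 0≤x n) (+-mono-≤ ≤-refl (*-monoˡ-≤ 0≤x (upper (exp-LUB 0≤x) n)))

    exp-mono-≤ : 0# ≤ x → x ≤ y → exp x ≤ exp y
    exp-mono-≤ 0≤x x≤y = minimal (exp-LUB 0≤x) _ λ n →
      ≤-trans (expSum-mono-≤ 0≤x x≤y n) (upper (exp-LUB (≤-trans 0≤x x≤y)) n)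

    exp-cong : 0# ≤ x → x ≈ y → exp x ≈ exp y
    exp-cong 0≤x x≈y = antisym (exp-mono-≤ 0≤x (≤-reflexive x≈y))
      (exp-mono-≤ (≤-trans 0≤x (≤-reflexive x≈y)) (≤-reflexive (sym x≈y)))

    LUB-*ʳ : ∀ {s l c b} → IsLUB s l → 0# < c → (∀ n → s n * c ≤ b) → l * c ≤ b
    LUB-*ʳ {s} {l} {c} {b} lub 0<c sc≤b = begin
      l * c      ≤⟨ *-monoʳ-≤ (proj₁ 0<c) (minimal lub (b / c) λ n → *-cancelˡ-≤ 0<c (begin
                      c * s n      ≈⟨ *-comm _ _ ⟩
                      s n * c      ≤⟨ sc≤b n ⟩
                      b            ≈⟨ x/y*y≈x 0<c ⟨
                      b / c * c    ≈⟨ *-comm _ _ ⟩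
                      c * (b / c)  ∎)) ⟩
      b / c * c  ≈⟨ x/y*y≈x 0<c ⟩
      b          ∎

    exp-+ : 0# ≤ x → 0# ≤ y → exp (x + y) ≈ exp x * exp y
    exp-+ {x} {y} 0≤x 0≤y = antisym
      (minimal (exp-LUB 0≤x+y) _ λ n → ≤-trans (expSum-+-≤ 0≤x 0≤y n)
        (*-mono-≤ (∑-nonneg (expTerm-nonneg 0≤x) n) (∑-nonneg (expTerm-nonneg 0≤y) n)
          (upper (exp-LUB 0≤x) n) (upper (exp-LUB 0≤y) n)))
      (LUB-*ʳ (exp-LUB 0≤x) (0<exp 0≤y) λ n → ≤-trans (≤-reflexive (*-comm _ _)) (y-LUB n))
      where
      0≤x+y = +-nonneg 0≤x 0≤y
      y-LUB : ∀ n → exp y * expSum x n ≤ exp (x + y)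
      -- The empty partial sum is 0, whereas `LUB-*ʳ` needs a positive factor.
      y-LUB n with em {0# < expSum x n}
      ... | yes 0<s = LUB-*ʳ (exp-LUB 0≤y) 0<s λ m → ≤-trans (≤-reflexive (*-comm _ _))
                        (≤-trans (expSum-+-≥ 0≤x 0≤y n m) (upper (exp-LUB 0≤x+y) (n ℕ.+ m)))
      ... | no  0≮s = ≤-trans (*-monoˡ-≤ (exp-nonneg 0≤y) (≮⇒≥ 0≮s))
                        (≤-trans (≤-reflexive (zeroʳ _)) (exp-nonneg 0≤x+y))

    exp-0 : exp 0# ≈ 1#
    exp-0 = antisym (≤-trans (exp≤1+x*exp ≤-refl) (≤-reflexive
      (solve 1 (λ e → :1 :+ :0 :* e := :1) refl (exp 0#)))) (1≤exp ≤-refl)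

    exp-ℕ* : 0# ≤ x → ∀ n → exp (fromℕ n * x) ≈ exp x ^ n
    exp-ℕ* {x} 0≤x zero    = trans (exp-cong (≤-reflexive (sym (zeroˡ x))) (zeroˡ x)) exp-0
    exp-ℕ* {x} 0≤x (suc n) = begin-equality
      exp (fromℕ (suc n) * x)    ≈⟨ exp-cong (*-nonneg (0≤fromℕ (suc n)) 0≤x)
                                      (solve 2 (λ k x → (:1 :+ k) :* x := x :+ k :* x) refl (fromℕ n) x) ⟩
      exp (x + fromℕ n * x)      ≈⟨ exp-+ 0≤x (*-nonneg (0≤fromℕ n) 0≤x) ⟩
      exp x * exp (fromℕ n * x)  ≈⟨ *-congˡ (exp-ℕ* 0≤x n) ⟩
      exp x * exp x ^ n          ∎

    exp-shift : 0# ≤ x → x ≤ y → exp y ≈ exp x * exp (y - x)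
    exp-shift {x} {y} 0≤x x≤y = trans
      (exp-cong (≤-trans 0≤x x≤y) (solve 2 (λ x y → y := x :+ (y :- x)) refl x y))
      (exp-+ 0≤x (x≤y⇒0≤y-x x≤y))

    exp-mono-< : 0# ≤ x → x < y → exp x < exp y
    exp-mono-< {x} {y} 0≤x x<y = ≰⇒> λ ey≤ex → <⇒≱ (x<y⇒0<y-x x<y) (+-cancelʳ-≤ 1# (begin
      y - x + 1#         ≈⟨ +-comm _ _ ⟩
      1# + (y - x)       ≤⟨ 1+x≤exp (x≤y⇒0≤y-x (proj₁ x<y)) ⟩
      exp (y - x)        ≤⟨ *-cancelˡ-≤ (0<exp 0≤x) (begin
        exp x * exp (y - x)  ≈⟨ exp-shift 0≤x (proj₁ x<y) ⟨
        exp y                ≤⟨ ey≤ex ⟩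
        exp x                ≈⟨ *-identityʳ _ ⟨
        exp x * 1#           ∎) ⟩
      1#                 ≈⟨ +-identityˡ 1# ⟨
      0# + 1#            ∎))

    exp-cancel-≤ : 0# ≤ y → exp x ≤ exp y → x ≤ y
    exp-cancel-≤ 0≤y ex≤ey = ≮⇒≥ λ y<x → <⇒≱ (exp-mono-< 0≤y y<x) ex≤ey

    exp[x]*[1-x]≤1 : 0# ≤ x → exp x * (1# - x) ≤ 1#
    exp[x]*[1-x]≤1 {x} 0≤x = ≤-by (1# + x * exp x - exp x) (x≤y⇒0≤y-x (exp≤1+x*exp 0≤x))
      (solve 2 (λ x e → :1 := e :* (:1 :- x) :+ (:1 :+ x :* e :- e)) refl x (exp x))

    -- The preimage is the supremum s of all y with exp y ≤ c. Continuity is replaced by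
    -- `exp[x]*[1-x]≤1`, which supplies an explicit step h: if exp s < c, then s + h still
    -- qualifies; if c < exp s, then s - h is already an upper bound.
    exp-surjective : ∀ {c} → 1# ≤ c → ∃ λ y → 0# ≤ y × exp y ≈ c
    exp-surjective {c} 1≤c = s , 0≤s , antisym (≮⇒≥ c≮exp) (≮⇒≥ exp≮c)
      where
      Below : Pred ℝ 0ℓ
      Below y = 0# ≤ y × exp y ≤ c

      sup = supremum Below
        (0# , ≤-refl , ≤-trans (≤-reflexive exp-0) 1≤c)
        (c , λ y (0≤y , ey≤c) → ≤-trans (≤-by 1# 0≤1 (+-comm _ _)) (≤-trans (1+x≤exp 0≤y) ey≤c))
      s   = proj₁ sup

      0<c : 0# < c
      0<c = <-≤-trans 0<1 1≤c

      0≤s : 0# ≤ s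
      0≤s = proj₁ (proj₂ sup) 0# (≤-refl , ≤-trans (≤-reflexive exp-0) 1≤c)

      0<es = 0<exp 0≤s

      exp≮c : ¬ (exp s < c)
      exp≮c es<c = <⇒≱ 0<h (+-cancelʳ-≤ s (≤-trans (≤-reflexive (+-comm h s)) (≤-trans
        (proj₁ (proj₂ sup) (s + h) (+-nonneg 0≤s 0≤h , bound)) (≤-reflexive (sym (+-identityˡ s))))))
        where
        -- Chosen so that exp s = c (1 - h).
        h    = (c - exp s) / c
        0<h  = /-pos (x<y⇒0<y-x es<c) 0<c
        0≤h  = proj₁ 0<h
        bound : exp (s + h) ≤ c
        bound = begin
          exp (s + h)                    ≈⟨ exp-+ 0≤s 0≤h ⟩
          exp s * exp h                  ≈⟨ *-congʳ (solve 2 (λ c e → e := c :- (c :- e)) refl c (exp s)) ⟩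
          (c - (c - exp s)) * exp h      ≈⟨ *-congʳ (+-congˡ (-‿cong (x/y*y≈x 0<c))) ⟨
          (c - h * c) * exp h            ≈⟨ solve 3 (λ c h e → (c :- h :* c) :* e := c :* (e :* (:1 :- h))) refl c h (exp h) ⟩
          c * (exp h * (1# - h))         ≤⟨ *-monoˡ-≤ (proj₁ 0<c) (exp[x]*[1-x]≤1 0≤h) ⟩
          c * 1#                         ≈⟨ *-identityʳ c ⟩
          c                              ∎

      c≮exp : ¬ (c < exp s)
      c≮exp c<es = <⇒≱ 0<h (≤-by (s - h - s) (x≤y⇒0≤y-x
        (proj₂ (proj₂ sup) (s - h) λ y (0≤y , ey≤c) → ≮⇒≥ λ s-h<y → <⇒≱ c<es (absurd 0≤y ey≤c s-h<y)))
        (solve 2 (λ s h → :0 := h :+ (s :- h :- s)) refl s h))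
        where
        d   = exp s - c
        0<d = x<y⇒0<y-x c<es
        -- Chosen so that exp s (1 - h) is the midpoint of c and exp s, which is still above c.
        h   = d / (exp s + exp s)
        0<2es = +-pos-nonneg 0<es (proj₁ 0<es)
        0<h = /-pos 0<d 0<2es
        0≤h = proj₁ 0<h
        h*2es≈d = x/y*y≈x {x = d} 0<2es
        absurd : ∀ {y} → 0# ≤ y → exp y ≤ c → s - h < y → exp s ≤ c
        absurd {y} 0≤y ey≤c s-h<y = ≤-by (w + w) (+-nonneg 0≤w 0≤w) (begin-equality
          c                                          ≈⟨ solve 2 (λ c e → c := e :+ c :+ c :- e :- e :+ (e :- c)) refl c es ⟩
          es + c + c - es - es + d                   ≈⟨ +-congˡ h*2es≈d ⟨
          es + c + c - es - es + h * (es + es)       ≈⟨ solve 3 (λ c e h → e :+ c :+ c :- e :- e :+ h :* (e :+ e) :=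
                                                          e :+ (c :- e :* (:1 :- h) :+ (c :- e :* (:1 :- h)))) refl c es h ⟩
          es + (w + w)                               ∎)
          where
          es = exp s
          w  = c - es * (1# - h)

          h≤1 : h ≤ 1#
          h≤1 = *-cancelˡ-≤ 0<2es (begin
            (es + es) * h    ≈⟨ *-comm _ _ ⟩
            h * (es + es)    ≈⟨ h*2es≈d ⟩
            es - c           ≤⟨ ≤-by (es + c) (+-nonneg (proj₁ 0<es) (proj₁ 0<c))
                                  (solve 2 (λ e c → (e :+ e) :* :1 := e :- c :+ (e :+ c)) refl es c) ⟩
            (es + es) * 1#   ∎)

          0≤w : 0# ≤ w
          0≤w = x≤y⇒0≤y-x (begin
            es * (1# - h)               ≤⟨ *-monoʳ-≤ (x≤y⇒0≤y-x h≤1) (begin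
              es                          ≤⟨ exp-mono-≤ 0≤s (≤-by (y - (s - h)) (x≤y⇒0≤y-x (proj₁ s-h<y))
                                               (solve 3 (λ s h y → y :+ h := s :+ (y :- (s :- h))) refl s h y)) ⟩
              exp (y + h)                 ≈⟨ exp-+ 0≤y 0≤h ⟩
              exp y * exp h               ∎) ⟩
            exp y * exp h * (1# - h)    ≈⟨ *-assoc _ _ _ ⟩
            exp y * (exp h * (1# - h))  ≤⟨ *-monoˡ-≤ (exp-nonneg 0≤y) (exp[x]*[1-x]≤1 0≤h) ⟩
            exp y * 1#                  ≈⟨ *-identityʳ _ ⟩
            exp y                       ≤⟨ ey≤c ⟩
            c                           ∎)

    -- The defect S a · S b - ∑ conv a b is nonnegative for nonnegative b and linear
    -- in b; apply this to the difference of the series of x and - x.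
    negative-expSum : 0# ≤ x → ∀ n → expSum x n * expSum (- x) n + expSum (x + x) n ≤ 1# + exp (x + x)
    negative-expSum {x} 0≤x n = begin
      Sa * Sy + expSum (x + x) n
        ≈⟨ +-congˡ (∑-cong (conv-expTerm x x) n) ⟨
      Sa * Sy + ∑[i< n ] conv a a
        ≈⟨ +-congˡ (∑-cong (λ i → conv-cong {a} {a} (λ _ → refl) a≈b+d i) n) ⟩
      Sa * Sy + ∑[i< n ] conv a (λ i → b i + d i)
        ≈⟨ +-congˡ (∑-cong (conv-+ʳ a b d) n) ⟩
      Sa * Sy + ∑[i< n ] (λ i → conv a b i + conv a d i)
        ≈⟨ +-congˡ (∑-+ {conv a b} {conv a d} n) ⟩
      Sa * Sy + (∑[i< n ] conv a b + ∑[i< n ] conv a d)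
        ≤⟨ +-mono-≤ ≤-refl (+-mono-≤ ≤-refl (∑-conv-≤ (expTerm-nonneg 0≤x) 0≤d n)) ⟩
      Sa * Sy + (∑[i< n ] conv a b + Sa * ∑[i< n ] d)
        ≈⟨ solve 4 (λ s y c d → s :* y :+ (c :+ s :* d) := c :+ s :* (y :+ d)) refl Sa Sy (∑[i< n ] conv a b) (∑[i< n ] d) ⟩
      ∑[i< n ] conv a b + Sa * (Sy + ∑[i< n ] d)
        ≈⟨ +-cong (∑-cong (λ i → trans (conv-expTerm x (- x) i) (expTerm-cong (-‿inverseʳ x) i)) n)
                  (*-congˡ (sym (trans (∑-cong a≈b+d n) (∑-+ {b} {d} n)))) ⟩
      expSum 0# n + Sa * Sa
        ≤⟨ +-mono-≤ (≤-trans (upper (exp-LUB ≤-refl) n) (≤-reflexive exp-0))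
             (≤-trans (expSum-+-≥ 0≤x 0≤x n n) (upper (exp-LUB (+-nonneg 0≤x 0≤x)) (n ℕ.+ n))) ⟩
      1# + exp (x + x) ∎
      where
      a b d : ℕ → ℝ
      a   = expTerm x
      b   = expTerm (- x)
      d i = a i - b i
      Sa  = expSum x n
      Sy  = expSum (- x) n

      a≈b+d : ∀ i → a i ≈ b i + d i
      a≈b+d i = solve 2 (λ a y → a := y :+ (a :- y)) refl (a i) (b i)

      power-bounds : ∀ i → (- x) ^ i ≤ x ^ i × - (x ^ i) ≤ (- x) ^ i
      power-bounds zero = ≤-refl , ≤-trans (neg-mono-≤ 0≤1) (≤-trans (≤-reflexive -0#≈0#) 0≤1)
      power-bounds (suc i) =
        let p , q = power-bounds i
            flip : ∀ u → - x * u ≈ x * - u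
            flip u = solve 2 (λ x u → :- x :* u := x :* :- u) refl x u
        in (begin
             - x * (- x) ^ i    ≈⟨ flip _ ⟩
             x * - ((- x) ^ i)  ≤⟨ *-monoˡ-≤ 0≤x (≤-trans (neg-mono-≤ q) (≤-reflexive (-‿involutive _))) ⟩
             x * x ^ i          ∎)
         , (begin
             - (x * x ^ i)      ≈⟨ solve 2 (λ x u → :- (x :* u) := x :* :- u) refl x (x ^ i) ⟩
             x * - (x ^ i)      ≤⟨ *-monoˡ-≤ 0≤x (neg-mono-≤ p) ⟩
             x * - ((- x) ^ i)  ≈⟨ flip _ ⟨
             - x * (- x) ^ i    ∎)

      0≤d : ∀ i → 0# ≤ d i
      0≤d i = x≤y⇒0≤y-x (*-monoʳ-≤ (proj₁ (x⁻¹-pos (0<fromℕ[n!] i))) (proj₁ (power-bounds i)))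

    -- Needed because log picks an arbitrary preimage under exp.
    1≤exp⇒0≤ : 1# ≤ exp y → 0# ≤ y
    1≤exp⇒0≤ {y} 1≤ey with lim-converges-or-0 (expSum y)
    -- A divergent series has the default value 0, which lies below 1.
    ... | inj₂ ey≡0 = contradiction (≤-trans 1≤ey (≤-reflexive (reflexive ey≡0))) (<⇒≱ 0<1)
    ... | inj₁ S⟶ey = ≮⇒≥ λ y<0 → absurd (- y) (sym (-‿involutive y))
        (<-≤-trans (x<y⇒0<y-x y<0) (≤-reflexive (+-identityˡ _)))
      where
      -- If y = - x is negative, the partial sums of x are eventually at least 1 + x and those of -
      -- x at least 1 - η, while `negative-expSum` keeps their product near 1.
      absurd : ∀ x → y ≈ - x → ¬ (0# < x)
      absurd x y≈-x 0<x = <⇒≱ 0<η (≤-by ((1# + η) - (1# + x) * (1# - η)) (x≤y⇒0≤y-x product-≤) (begin-equality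
          0#                                               ≈⟨ -‿inverseʳ x ⟨
          x - x                                            ≈⟨ +-congʳ (x/y*y≈x 0<x+3) ⟨
          η * (x + fromℕ 3) - x                            ≈⟨ solve 2 (λ x η →
              η :* (x :+ (:1 :+ (:1 :+ (:1 :+ :0)))) :- x :=
              η :+ ((:1 :+ η) :- (:1 :+ x) :* (:1 :- η))) refl x η ⟩
          η + ((1# + η) - (1# + x) * (1# - η))             ∎))
        where
        0≤x = proj₁ 0<x
        0<x+3 = +-pos-nonneg 0<x (0≤fromℕ 3)
        -- With this η, (1 + x) (1 - η) exceeds 1 + η by exactly η.
        η   = x / (x + fromℕ 3)
        0<η = /-pos 0<x 0<x+3

        η≤1 : η ≤ 1#
        η≤1 = *-cancelˡ-≤ 0<x+3 (begin
          (x + fromℕ 3) * η   ≈⟨ *-comm _ _ ⟩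
          η * (x + fromℕ 3)   ≈⟨ x/y*y≈x 0<x+3 ⟩
          x                   ≤⟨ ≤-by (fromℕ 3) (0≤fromℕ 3) (*-identityʳ _) ⟩
          (x + fromℕ 3) * 1#  ∎)

        0≤2x  = +-nonneg 0≤x 0≤x
        M     = proj₁ (S⟶ey η 0<η)
        close = proj₂ (S⟶ey η 0<η)
        N,near = approached (exp-LUB 0≤2x) η 0<η
        N     = proj₁ N,near
        n     = 2 ℕ.⊔ (M ℕ.⊔ N)
        M≤n : M ℕ.≤ n
        M≤n   = ℕ.≤-trans (ℕ.m≤m⊔n M N) (ℕ.m≤n⊔m 2 _)
        N≤n : N ℕ.≤ n
        N≤n   = ℕ.≤-trans (ℕ.m≤n⊔m M N) (ℕ.m≤n⊔m 2 _)

        1-η≤S : 1# - η ≤ expSum (- x) n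
        1-η≤S = +-cancelʳ-≤ η (begin
          1# - η + η            ≈⟨ solve 1 (λ η → :1 :- η :+ η := :1) refl η ⟩
          1#                    ≤⟨ 1≤ey ⟩
          exp y                 ≤⟨ ∣x-y∣≤⇒y≤ (expSum y n) (exp y) (close n M≤n) ⟩
          expSum y n + η        ≈⟨ +-congʳ (∑-cong (expTerm-cong y≈-x) n) ⟩
          expSum (- x) n + η    ∎)

        1+x≤S : 1# + x ≤ expSum x n
        1+x≤S = ≤-trans (≤-reflexive (sym (expSum-2 x))) (expSum-mono-length 0≤x {2} {n} (ℕ.m≤m⊔n 2 (M ℕ.⊔ N)))

        product-≤ : (1# + x) * (1# - η) ≤ 1# + η
        product-≤ = +-cancelʳ-≤ (expSum (x + x) n) (begin
          (1# + x) * (1# - η) + expSum (x + x) n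
            ≤⟨ +-monoˡ-≤ _ (*-mono-≤ (+-nonneg 0≤1 0≤x) (x≤y⇒0≤y-x η≤1) 1+x≤S 1-η≤S) ⟩
          expSum x n * expSum (- x) n + expSum (x + x) n
            ≤⟨ negative-expSum 0≤x n ⟩
          1# + exp (x + x)
            ≤⟨ +-mono-≤ ≤-refl (≤-trans (proj₂ N,near) (+-monoˡ-≤ η (expSum-mono-length 0≤2x N≤n))) ⟩
          1# + (expSum (x + x) n + η)
            ≈⟨ solve 2 (λ s η → :1 :+ (s :+ η) := :1 :+ η :+ s) refl (expSum (x + x) n) η ⟩
          1# + η + expSum (x + x) n ∎)

    abstract
      log-inverse : 1# ≤ x → 0# ≤ log x × exp (log x) ≈ x
      log-inverse {x} 1≤x with em {∃ λ y → exp y ≈ x}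
      ... | yes (y , ey≈x) = 1≤exp⇒0≤ (≤-trans 1≤x (≤-reflexive (sym ey≈x))) , ey≈x
      ... | no  none       = let y , _ , ey≈x = exp-surjective 1≤x in contradiction (y , ey≈x) none

  open Exponential

  -- Finite probability spaces.

  module Randomness where

    private variable
      X Y P Q : Set

    -- Finite binary trees of biased coins; mix q d e is e with probability q.
    data Dist (X : Set) : Set where
      ret : X → Dist X
      mix : (q : ℝ) → 0# ≤ q → q ≤ 1# → Dist X → Dist X → Dist X

    𝔼 : Dist X → (X → ℝ) → ℝ
    𝔼 (ret x)         g = g x
    𝔼 (mix q _ _ d e) g = (1# - q) * 𝔼 d g + q * 𝔼 e g

    map : (X → Y) → Dist X → Dist Y
    map f (ret x)           = ret (f x)
    map f (mix q 0≤q q≤1 d e) = mix q 0≤q q≤1 (map f d) (map f e)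

    infixr 5 _⊗_
    _⊗_ : Dist X → Dist Y → Dist (X × Y)
    ret x             ⊗ d′ = map (x ,_) d′
    mix q 0≤q q≤1 d e ⊗ d′ = mix q 0≤q q≤1 (d ⊗ d′) (e ⊗ d′)

    𝔼-map : ∀ (f : X → Y) d g → 𝔼 (map f d) g ≈ 𝔼 d (g ∘ f)
    𝔼-map f (ret x)         g = refl
    𝔼-map f (mix q _ _ d e) g = +-cong (*-congˡ (𝔼-map f d g)) (*-congˡ (𝔼-map f e g))

    𝔼-⊗ : ∀ (d : Dist X) (d′ : Dist Y) g → 𝔼 (d ⊗ d′) g ≈ 𝔼 d (λ x → 𝔼 d′ (λ y → g (x , y)))
    𝔼-⊗ (ret x)         d′ g = 𝔼-map (x ,_) d′ g
    𝔼-⊗ (mix q _ _ d e) d′ g = +-cong (*-congˡ (𝔼-⊗ d d′ g)) (*-congˡ (𝔼-⊗ e d′ g))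

    𝔼-mono-≤ : ∀ (d : Dist X) {g h} → (∀ x → g x ≤ h x) → 𝔼 d g ≤ 𝔼 d h
    𝔼-mono-≤ (ret x)             g≤h = g≤h x
    𝔼-mono-≤ (mix q 0≤q q≤1 d e) g≤h = +-mono-≤
      (*-monoˡ-≤ (x≤y⇒0≤y-x q≤1) (𝔼-mono-≤ d g≤h)) (*-monoˡ-≤ 0≤q (𝔼-mono-≤ e g≤h))

    𝔼-cong : ∀ (d : Dist X) {g h} → (∀ x → g x ≈ h x) → 𝔼 d g ≈ 𝔼 d h
    𝔼-cong d g≈h = antisym (𝔼-mono-≤ d (λ x → ≤-reflexive (g≈h x)))
                           (𝔼-mono-≤ d (λ x → ≤-reflexive (sym (g≈h x))))

    𝔼-+ : ∀ (d : Dist X) g h → 𝔼 d (λ x → g x + h x) ≈ 𝔼 d g + 𝔼 d h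
    𝔼-+ (ret x)         g h = refl
    𝔼-+ (mix q _ _ d e) g h = trans (+-cong (*-congˡ (𝔼-+ d g h)) (*-congˡ (𝔼-+ e g h)))
      (solve 5 (λ q a b c d → (:1 :- q) :* (a :+ b) :+ q :* (c :+ d)
                           := (:1 :- q) :* a :+ q :* c :+ ((:1 :- q) :* b :+ q :* d)) refl
        q (𝔼 d g) (𝔼 d h) (𝔼 e g) (𝔼 e h))

    𝔼-*ˡ : ∀ (d : Dist X) c g → 𝔼 d (λ x → c * g x) ≈ c * 𝔼 d g
    𝔼-*ˡ (ret x)         c g = refl
    𝔼-*ˡ (mix q _ _ d e) c g = trans (+-cong (*-congˡ (𝔼-*ˡ d c g)) (*-congˡ (𝔼-*ˡ e c g)))
      (solve 4 (λ q c a b → (:1 :- q) :* (c :* a) :+ q :* (c :* b) := c :* ((:1 :- q) :* a :+ q :* b)) refl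
        q c (𝔼 d g) (𝔼 e g))

    𝔼-const : ∀ (d : Dist X) c → 𝔼 d (λ _ → c) ≈ c
    𝔼-const (ret x)         c = refl
    𝔼-const (mix q _ _ d e) c = trans (+-cong (*-congˡ (𝔼-const d c)) (*-congˡ (𝔼-const e c)))
      (solve 2 (λ q c → (:1 :- q) :* c :+ q :* c := c) refl q c)

    𝔼-nonneg : ∀ (d : Dist X) {g} → (∀ x → 0# ≤ g x) → 0# ≤ 𝔼 d g
    𝔼-nonneg d 0≤g = ≤-trans (≤-reflexive (sym (𝔼-const d 0#))) (𝔼-mono-≤ d 0≤g)

    𝟙 : Set → ℝ
    𝟙 P with em {P}
    ... | yes _ = 1#
    ... | no  _ = 0#

    0≤𝟙 : ∀ P → 0# ≤ 𝟙 P
    0≤𝟙 P with em {P}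
    ... | yes _ = 0≤1
    ... | no  _ = ≤-refl

    𝟙≤1 : ∀ P → 𝟙 P ≤ 1#
    𝟙≤1 P with em {P}
    ... | yes _ = ≤-refl
    ... | no  _ = 0≤1

    𝟙-true : P → 𝟙 P ≈ 1#
    𝟙-true {P} p with em {P}
    ... | yes _  = refl
    ... | no  ¬p = contradiction p ¬p

    𝟙-false : ¬ P → 𝟙 P ≈ 0#
    𝟙-false {P} ¬p with em {P}
    ... | yes p = contradiction p ¬p
    ... | no  _ = refl

    𝟙-mono-≤ : (P → Q) → 𝟙 P ≤ 𝟙 Q
    𝟙-mono-≤ {P} {Q} P→Q with em {P}
    ... | yes p = ≤-reflexive (sym (𝟙-true (P→Q p)))
    ... | no  _ = 0≤𝟙 Q

    𝟙-∪ : ∀ {P Q R : Set} → (P → Q ⊎ R) → 𝟙 P ≤ 𝟙 Q + 𝟙 R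
    𝟙-∪ {P} {Q} {R} P→Q⊎R with em {P}
    ... | no _ = +-nonneg (0≤𝟙 Q) (0≤𝟙 R)
    ... | yes p with P→Q⊎R p
    ...   | inj₁ q = ≤-by (𝟙 R) (0≤𝟙 R) (+-congʳ (𝟙-true q))
    ...   | inj₂ r = ≤-by (𝟙 Q) (0≤𝟙 Q) (trans (+-comm _ _) (+-congʳ (𝟙-true r)))

    ℙ : Dist X → Pred X 0ℓ → ℝ
    ℙ d S = 𝔼 d (λ x → 𝟙 (S x))

    ℙ-mono-≤ : ∀ (d : Dist X) {S S′ : Pred X 0ℓ} → (∀ x → S x → S′ x) → ℙ d S ≤ ℙ d S′
    ℙ-mono-≤ d S⊆S′ = 𝔼-mono-≤ d (λ x → 𝟙-mono-≤ (S⊆S′ x))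

    ℙ-nonneg : ∀ (d : Dist X) (S : Pred X 0ℓ) → 0# ≤ ℙ d S
    ℙ-nonneg d S = 𝔼-nonneg d (λ x → 0≤𝟙 (S x))

    ℙ-≤1 : ∀ (d : Dist X) (S : Pred X 0ℓ) → ℙ d S ≤ 1#
    ℙ-≤1 d S = ≤-trans (𝔼-mono-≤ d (λ x → 𝟙≤1 (S x))) (≤-reflexive (𝔼-const d 1#))

    ℙ-complement : ∀ (d : Dist X) (S : Pred X 0ℓ) → 1# ≤ ℙ d S + ℙ d (λ x → ¬ S x)
    ℙ-complement d S = begin
      1#                                      ≈⟨ 𝔼-const d 1# ⟨
      𝔼 d (λ _ → 1#)                          ≤⟨ 𝔼-mono-≤ d (λ x → ≤-trans
                                                   (≤-reflexive (sym (𝟙-true tt))) (𝟙-∪ λ (_ : ⊤) → decide (S x))) ⟩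
      𝔼 d (λ x → 𝟙 (S x) + 𝟙 (¬ S x))         ≈⟨ 𝔼-+ d _ _ ⟩
      ℙ d S + ℙ d (λ x → ¬ S x)               ∎
      where
      decide : ∀ P → P ⊎ ¬ P
      decide P with em {P}
      ... | yes p = inj₁ p
      ... | no ¬p = inj₂ ¬p

    ℙ-⊗-∪ : ∀ (d : Dist X) (e : Dist Y) {S : Pred (X × Y) 0ℓ} {S₁ : Pred X 0ℓ} {S₂ : Pred Y 0ℓ} →
            (∀ x y → S (x , y) → S₁ x ⊎ S₂ y) → ℙ (d ⊗ e) S ≤ ℙ d S₁ + ℙ e S₂
    ℙ-⊗-∪ d e {S} {S₁} {S₂} cover = begin
      ℙ (d ⊗ e) S                                      ≈⟨ 𝔼-⊗ d e (λ xy → 𝟙 (S xy)) ⟩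
      𝔼 d (λ x → 𝔼 e (λ y → 𝟙 (S (x , y))))            ≤⟨ 𝔼-mono-≤ d (λ x → 𝔼-mono-≤ e (λ y → 𝟙-∪ (cover x y))) ⟩
      𝔼 d (λ x → 𝔼 e (λ y → 𝟙 (S₁ x) + 𝟙 (S₂ y)))      ≈⟨ 𝔼-cong d (λ x → trans (𝔼-+ e _ _) (+-congʳ (𝔼-const e _))) ⟩
      𝔼 d (λ x → 𝟙 (S₁ x) + ℙ e S₂)                    ≈⟨ trans (𝔼-+ d _ _) (+-congˡ (𝔼-const d _)) ⟩
      ℙ d S₁ + ℙ e S₂                                  ∎

    ∑-0 : ∀ {s : ℕ → ℝ} → (∀ i → s i ≈ 0#) → ∀ n → ∑[i< n ] s ≈ 0#
    ∑-0 s≈0 zero    = refl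
    ∑-0 s≈0 (suc n) = trans (+-cong (s≈0 0) (∑-0 (s≈0 ∘ suc) n)) (+-identityˡ 0#)

    ∑-only : ∀ {s : ℕ → ℝ} k → (∀ i → i ≢ k → s i ≈ 0#) → ∀ {n} → k ℕ.< n → ∑[i< n ] s ≈ s k
    ∑-only zero    others {suc n} _         =
      trans (+-congˡ (∑-0 (λ i → others (suc i) λ ()) n)) (+-identityʳ _)
    ∑-only (suc k) others {suc n} (s≤s k<n) = trans
      (+-cong (others 0 λ ()) (∑-only k (λ i i≢k → others (suc i) (i≢k ∘ ℕ.suc-injective)) k<n))
      (+-identityˡ _)

    -- Each leaf of the tree lies in at most one of the disjoint events, and there are finitely many
    -- leaves, so the partial sums are eventually constant.
    ∑-ℙ-⋃ : ∀ (d : Dist X) {S : ℕ → Pred X 0ℓ} → (∀ {m n} → m ≢ n → S m ⊥ S n) →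
            ∃ λ N → ∀ n → N ℕ.≤ n → ∑[i< n ] (λ i → ℙ d (S i)) ≈ ℙ d (⋃ ℕ S)
    ∑-ℙ-⋃ (ret x) {S} disjoint with em {⋃ ℕ S x}
    ... | yes (k , x∈Sk) = suc k , λ n k<n →
          trans (∑-only k (λ i i≢k → 𝟙-false λ x∈Si → disjoint i≢k (x∈Si , x∈Sk)) k<n) (𝟙-true x∈Sk)
    ... | no  x∉⋃        = 0 , λ n _ → ∑-0 (λ i → 𝟙-false λ x∈Si → x∉⋃ (i , x∈Si)) n
    ∑-ℙ-⋃ (mix q _ _ d e) {S} disjoint =
      let M , ∑d = ∑-ℙ-⋃ d disjoint
          N , ∑e = ∑-ℙ-⋃ e disjoint
      in M ℕ.⊔ N , λ n M⊔N≤n → begin-equality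
        ∑[i< n ] (λ i → (1# - q) * ℙ d (S i) + q * ℙ e (S i))
          ≈⟨ ∑-+ {λ i → (1# - q) * ℙ d (S i)} {λ i → q * ℙ e (S i)} n ⟩
        ∑[i< n ] (λ i → (1# - q) * ℙ d (S i)) + ∑[i< n ] (λ i → q * ℙ e (S i))
          ≈⟨ +-cong (∑-*ˡ (1# - q) (λ i → ℙ d (S i)) n) (∑-*ˡ q (λ i → ℙ e (S i)) n) ⟩
        (1# - q) * ∑[i< n ] (λ i → ℙ d (S i)) + q * ∑[i< n ] (λ i → ℙ e (S i))
          ≈⟨ +-cong (*-congˡ (∑d n (ℕ.≤-trans (ℕ.m≤m⊔n M N) M⊔N≤n)))
                    (*-congˡ (∑e n (ℕ.≤-trans (ℕ.m≤n⊔m M N) M⊔N≤n))) ⟩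
        (1# - q) * ℙ d (⋃ ℕ S) + q * ℙ e (⋃ ℕ S) ∎

    -- With finitely many leaves every predicate can serve as an event, which trivialises all
    -- measurability conditions.
    finiteSpace : Dist X → ProbabilitySpace
    finiteSpace {X} d = record
      { Ω         = X
      ; IsEvent   = λ _ → Lift (lsuc 0ℓ) ⊤
      ; event-≐   = λ _ _ → lift tt
      ; event-U   = lift tt
      ; event-∁   = λ _ → lift tt
      ; event-⋃   = λ _ → lift tt
      ; Pr        = ℙ d
      ; Pr-≐      = λ _ (E⊆F , F⊆E) → antisym (ℙ-mono-≤ d λ _ → E⊆F) (ℙ-mono-≤ d λ _ → F⊆E)
      ; Pr-nonneg = λ {E} _ → ℙ-nonneg d E
      ; Pr-U      = trans (𝔼-cong d (λ _ → 𝟙-true tt)) (𝔼-const d 1#)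
      ; Pr-⋃      = λ {E} _ disjoint η 0<η →
          let N , stable = ∑-ℙ-⋃ d disjoint in
          N , λ n N≤n →
            let s-l≈0 = trans (+-congʳ (stable n N≤n)) (-‿inverseʳ (ℙ d (⋃ ℕ E))) in
            ∣x∣≤ (≤-trans (≤-reflexive s-l≈0) (proj₁ 0<η))
                 (≤-trans (≤-reflexive (trans (-‿cong s-l≈0) -0#≈0#)) (proj₁ 0<η))
      }

    -- Truncated geometric noise: shifts and tails.

    module Noise (q : ℝ) (0≤q : 0# ≤ q) (q≤1 : q ≤ 1#) where

      -- The geometric distribution with its tail collapsed onto the point N.
      geometric : ℕ → Dist ℕ
      geometric zero    = ret 0
      geometric (suc N) = mix q 0≤q q≤1 (ret 0) (map suc (geometric N))

      -- Such functions cannot tell the collapsed tail from the full one, so shifting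
      -- the noise costs exactly what it costs for untruncated geometric noise.
      Saturates : ℕ → (ℕ → ℝ) → Set
      Saturates N g = ∀ i → N ℕ.≤ i → g i ≈ g N

      saturates-shift : ∀ {N g} → Saturates N g → Saturates N (g ∘ suc)
      saturates-shift {N} sat i N≤i =
        trans (sat (suc i) (ℕ.m≤n⇒m≤1+n N≤i)) (sym (sat (suc N) (ℕ.n≤1+n N)))

      𝔼-geometric-suc : ∀ N g → 𝔼 (geometric (suc N)) g ≈ (1# - q) * g 0 + q * 𝔼 (geometric N) (g ∘ suc)
      𝔼-geometric-suc N g = +-congˡ (*-congˡ (𝔼-map suc (geometric N) g))

      -- Raising the truncation point by one moves mass only within the range where g is constant.
      𝔼-geometric-saturated : ∀ N {g} → Saturates N g → 𝔼 (geometric (suc N)) g ≈ 𝔼 (geometric N) g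
      𝔼-geometric-saturated zero {g} sat = trans (+-congˡ (*-congˡ (sat 1 z≤n)))
        (solve 2 (λ q a → (:1 :- q) :* a :+ q :* a := a) refl q (g 0))
      𝔼-geometric-saturated (suc N) {g} sat = begin-equality
        𝔼 (geometric (suc (suc N))) g                              ≈⟨ 𝔼-geometric-suc (suc N) g ⟩
        (1# - q) * g 0 + q * 𝔼 (geometric (suc N)) (g ∘ suc)       ≈⟨ +-congˡ (*-congˡ
          (𝔼-geometric-saturated N (λ i N≤i → sat (suc i) (s≤s N≤i)))) ⟩
        (1# - q) * g 0 + q * 𝔼 (geometric N) (g ∘ suc)             ≈⟨ 𝔼-geometric-suc N g ⟨
        𝔼 (geometric (suc N)) g                                    ∎

      -- With probability q the noise is one plus noise truncated one point earlier; discarding the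
      -- outcome 0 leaves the left-hand side, except for the truncation point, which
      -- `𝔼-geometric-saturated` repairs.
      𝔼-geometric-shift₁ : ∀ N {g} → Saturates N g → (∀ i → 0# ≤ g i) →
                           q * 𝔼 (geometric N) (g ∘ suc) ≤ 𝔼 (geometric N) g
      𝔼-geometric-shift₁ zero {g} sat 0≤g = begin
        q * g 1   ≈⟨ *-congˡ (sat 1 z≤n) ⟩
        q * g 0   ≤⟨ *-monoʳ-≤ (0≤g 0) q≤1 ⟩
        1# * g 0  ≈⟨ *-identityˡ _ ⟩
        g 0       ∎
      𝔼-geometric-shift₁ (suc N) {g} sat 0≤g = begin
        q * 𝔼 (geometric (suc N)) (g ∘ suc)             ≈⟨ *-congˡ
          (𝔼-geometric-saturated N (λ i N≤i → sat (suc i) (s≤s N≤i))) ⟩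
        q * 𝔼 (geometric N) (g ∘ suc)                   ≤⟨ ≤-by _ (*-nonneg (x≤y⇒0≤y-x q≤1) (0≤g 0)) (+-comm _ _) ⟩
        (1# - q) * g 0 + q * 𝔼 (geometric N) (g ∘ suc)  ≈⟨ 𝔼-geometric-suc N g ⟨
        𝔼 (geometric (suc N)) g                         ∎

      -- The source of the privacy loss. It is applied with s = m to the threshold noise and with s
      -- at most 2 m to the noise at a jump.
      𝔼-geometric-shift : ∀ s N {g} → Saturates N g → (∀ i → 0# ≤ g i) →
                          q ^ s * 𝔼 (geometric N) (λ i → g (s ℕ.+ i)) ≤ 𝔼 (geometric N) g
      𝔼-geometric-shift zero    N sat 0≤g = ≤-reflexive (*-identityˡ _)
      𝔼-geometric-shift (suc s) N {g} sat 0≤g = begin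
        q * q ^ s * 𝔼 (geometric N) (λ i → g (suc (s ℕ.+ i)))    ≈⟨ *-assoc _ _ _ ⟩
        q * (q ^ s * 𝔼 (geometric N) (λ i → g (suc (s ℕ.+ i))))  ≤⟨ *-monoˡ-≤ 0≤q
          (𝔼-geometric-shift s N (saturates-shift sat) (0≤g ∘ suc)) ⟩
        q * 𝔼 (geometric N) (g ∘ suc)                            ≤⟨ 𝔼-geometric-shift₁ N sat 0≤g ⟩
        𝔼 (geometric N) g                                        ∎

      geometric-tail : ∀ i N → ℙ (geometric N) (i ℕ.<_) ≤ q ^ i
      geometric-tail zero    N       = ℙ-≤1 (geometric N) _
      geometric-tail (suc i) zero    = ≤-trans (≤-reflexive (𝟙-false λ ())) (^-nonneg 0≤q (suc i))
      geometric-tail (suc i) (suc N) = begin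
        ℙ (geometric (suc N)) (suc i ℕ.<_)
          ≈⟨ 𝔼-geometric-suc N (λ y → 𝟙 (suc i ℕ.< y)) ⟩
        (1# - q) * 𝟙 (suc i ℕ.< 0) + q * ℙ (geometric N) (λ y → suc i ℕ.< suc y)
          ≤⟨ +-mono-≤ (≤-reflexive (trans (*-congˡ (𝟙-false λ ())) (zeroʳ _)))
               (*-monoˡ-≤ 0≤q (≤-trans (ℙ-mono-≤ (geometric N) (λ _ → ℕ.s<s⁻¹)) (geometric-tail i N))) ⟩
        0# + q * q ^ i
          ≈⟨ +-identityˡ _ ⟩
        q * q ^ i ∎

      noises : ℕ → ∀ T → Dist (Vec ℕ T)
      noises N zero    = ret []
      noises N (suc T) = map (λ (y , ys) → y ∷ ys) (geometric N ⊗ noises N T)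

      𝔼-noises-suc : ∀ N T (g : Vec ℕ (suc T) → ℝ) →
                     𝔼 (noises N (suc T)) g ≈ 𝔼 (geometric N) (λ y → 𝔼 (noises N T) (λ ys → g (y ∷ ys)))
      𝔼-noises-suc N T g = trans (𝔼-map _ (geometric N ⊗ noises N T) g) (𝔼-⊗ (geometric N) (noises N T) _)

      noises-tail : ∀ i N T → ℙ (noises N T) (λ ys → ¬ All (ℕ._≤ i) ys) ≤ fromℕ T * q ^ i
      noises-tail i N zero    = ≤-reflexive (trans (𝟙-false λ ¬[] → ¬[] []) (sym (zeroˡ _)))
      noises-tail i N (suc T) = begin
        ℙ (noises N (suc T)) (λ ys → ¬ All (ℕ._≤ i) ys)
          ≈⟨ 𝔼-map _ (geometric N ⊗ noises N T) _ ⟩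
        ℙ (geometric N ⊗ noises N T) (λ (y , ys) → ¬ All (ℕ._≤ i) (y ∷ ys))
          ≤⟨ ℙ-⊗-∪ (geometric N) (noises N T) split ⟩
        ℙ (geometric N) (i ℕ.<_) + ℙ (noises N T) (λ ys → ¬ All (ℕ._≤ i) ys)
          ≤⟨ +-mono-≤ (geometric-tail i N) (noises-tail i N T) ⟩
        q ^ i + fromℕ T * q ^ i
          ≈⟨ solve 2 (λ p t → p :+ t :* p := (:1 :+ t) :* p) refl (q ^ i) (fromℕ T) ⟩
        fromℕ (suc T) * q ^ i ∎
        where
        split : ∀ y (ys : Vec ℕ T) → ¬ All (ℕ._≤ i) (y ∷ ys) → i ℕ.< y ⊎ ¬ All (ℕ._≤ i) ys
        split y ys ¬all with y ℕ.≤? i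
        ... | yes y≤i = inj₂ λ all → ¬all (y≤i ∷ all)
        ... | no  y≰i = inj₁ (ℕ.≰⇒> y≰i)

  open Randomness

  -- The sparse vector mechanism on sequences of natural scores.

  module Mechanism where

    -- Outputs are compared only pointwise and up to `_≈_`, which an arbitrary predicate need not
    -- respect. Half-spaces do, and complements and unions inherit it.
    borel-resp : ∀ {T} {S : Pred (Fin T → ℝ) 0ℓ} → Borel S →
                 ∀ {a b} → (∀ t → a t ≈ b t) → S a → S b
    borel-resp (half-space t c)           a≈b at≤c    = ≤-trans (≤-reflexive (sym (a≈b t))) at≤c
    borel-resp (complement S)             a≈b a∉S b∈S = a∉S (borel-resp S (sym ∘ a≈b) b∈S)
    borel-resp (union S)                  a≈b (n , p) = n , borel-resp (S n) a≈b p
    borel-resp (resp-≐ (S⊆S′ , S′⊆S) S)   a≈b a∈S′    = S⊆S′ (borel-resp S a≈b (S′⊆S a∈S′))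

    n∸m≡1+[n∸1+m] : ∀ {m n} → m ℕ.< n → n ℕ.∸ m ≡ suc (n ℕ.∸ suc m)
    n∸m≡1+[n∸1+m] (s≤s m≤n) = ℕ.+-∸-assoc 1 m≤n

    module SparseVector
      (q : ℝ) (0≤q : 0# ≤ q) (q≤1 : q ≤ 1#)
      (R K m : ℕ) (level : ℕ → ℕ)
      (level-mono : ∀ {v w} → v ℕ.≤ w → level v ℕ.≤ level w)
      (level≤K : ∀ v → level v ℕ.≤ K)
      where

      open Noise q 0≤q q≤1

      -- The cut-off at R and the truncated subtraction of the threshold noise z in
      -- trace make both noises saturate at R.
      next : ℕ → ℕ → ℕ
      next j v = j ℕ.⊔ level (v ℕ.⊓ R)

      trace : ∀ {T} → ℕ → ℕ → Vec ℕ T → Vec ℕ T → Vec ℕ T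
      trace z j []       []       = []
      trace z j (x ∷ xs) (y ∷ ys) =
        let j′ = next j (x ℕ.∸ z ℕ.+ y) in j′ ∷ trace z j′ xs ys

      -- The part of the budget, as an exponent of q, that state j may still spend: every jump
      -- raises the state by at least 1, never above K, and is charged 2 m.
      cost : ℕ → ℕ
      cost j = (K ℕ.∸ j) ℕ.* (m ℕ.+ m)

      cost-antimono : ∀ {i j} → i ℕ.≤ j → cost j ℕ.≤ cost i
      cost-antimono i≤j = ℕ.*-monoˡ-≤ (m ℕ.+ m) (ℕ.∸-monoʳ-≤ K i≤j)

      cost-suc : ∀ {j} → j ℕ.< K → cost j ≡ m ℕ.+ m ℕ.+ cost (suc j)
      cost-suc {j} j<K = ≡.cong (ℕ._* (m ℕ.+ m)) (n∸m≡1+[n∸1+m] j<K)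

      -- A single time step. `g i` and `g′ i` stand for the probabilities, under the two inputs,
      -- that the run from state i has the required continuation.
      module Step
        (j : ℕ) (g g′ : ℕ → ℝ) (0≤g : ∀ i → 0# ≤ g i) (0≤g′ : ∀ i → 0# ≤ g′ i)
        (g≤g′ : ∀ i → j ℕ.≤ i → q ^ cost i * g i ≤ g′ i)
        where

        -- The two summands of `h (next j v)`. They are separated because staying is compared for
        -- equal noise, at no cost, and jumping only after a shift of the noise.
        stay jump : (ℕ → ℝ) → ℕ → ℝ
        stay h v with level (v ℕ.⊓ R) ℕ.≤? j
        ... | yes _ = h j
        ... | no  _ = 0#
        jump h v with level (v ℕ.⊓ R) ℕ.≤? j
        ... | yes _ = 0#
        ... | no  _ = h (next j v)

        stay+jump : ∀ h v → h (next j v) ≈ stay h v + jump h v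
        stay+jump h v with level (v ℕ.⊓ R) ℕ.≤? j
        ... | yes l≤j = trans (reflexive (≡.cong h (ℕ.m≥n⇒m⊔n≡m l≤j))) (sym (+-identityʳ _))
        ... | no  _   = sym (+-identityˡ _)

        stay-nonneg : ∀ v → 0# ≤ stay g′ v
        stay-nonneg v with level (v ℕ.⊓ R) ℕ.≤? j
        ... | yes _ = 0≤g′ j
        ... | no  _ = ≤-refl

        jump-nonneg : ∀ v → 0# ≤ jump g′ v
        jump-nonneg v with level (v ℕ.⊓ R) ℕ.≤? j
        ... | yes _ = ≤-refl
        ... | no  _ = 0≤g′ _

        -- A smaller noisy score cannot jump where a larger one stays. This one-sidedness is why the
        -- threshold noise is moved so as to lower the noisy scores of the other input.
        stay-≤ : ∀ {v v′} → v′ ℕ.≤ v → q ^ cost j * stay g v ≤ stay g′ v′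
        stay-≤ {v} {v′} v′≤v with level (v ℕ.⊓ R) ℕ.≤? j
        ... | no  _   = ≤-trans (≤-reflexive (zeroʳ _)) (stay-nonneg v′)
        ... | yes l≤j with level (v′ ℕ.⊓ R) ℕ.≤? j
        ...   | yes _    = g≤g′ j ℕ.≤-refl
        ...   | no  l′≰j = contradiction
                (ℕ.≤-trans (level-mono (ℕ.⊓-monoˡ-≤ R v′≤v)) l≤j) l′≰j

        -- After a jump the remaining cost is lower by at least 2 m; the released factor
        -- `q ^ (m + m)` pays for the shift of the noise.
        jump-≤ : ∀ v → q ^ cost j * jump g v ≤ q ^ (m ℕ.+ m) * jump g′ v
        jump-≤ v with level (v ℕ.⊓ R) ℕ.≤? j
        ... | yes _   = ≤-reflexive (trans (zeroʳ _) (sym (zeroʳ _)))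
        ... | no  l≰j = begin
          q ^ cost j * g i                             ≡⟨ ≡.cong (λ n → q ^ n * g i) (cost-suc j<K) ⟩
          q ^ (m ℕ.+ m ℕ.+ cost (suc j)) * g i         ≈⟨ *-congʳ (^-homo-* q (m ℕ.+ m) (cost (suc j))) ⟩
          q ^ (m ℕ.+ m) * q ^ cost (suc j) * g i       ≈⟨ *-assoc _ _ _ ⟩
          q ^ (m ℕ.+ m) * (q ^ cost (suc j) * g i)     ≤⟨ *-monoˡ-≤ (^-nonneg 0≤q (m ℕ.+ m)) (≤-trans
            (*-monoʳ-≤ (0≤g i) (^-antimono-exponent 0≤q q≤1 (cost-antimono j<i)))
            (g≤g′ i (ℕ.<⇒≤ j<i))) ⟩
          q ^ (m ℕ.+ m) * g′ i                         ∎
          where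
          i   = next j v
          j<l = ℕ.≰⇒> l≰j
          j<K = ℕ.<-≤-trans j<l (level≤K _)
          j<i : j ℕ.< i
          j<i = ℕ.<-≤-trans j<l (ℕ.m≤n⊔m j _)

        jump-cong : ∀ {v w} → v ℕ.⊓ R ≡ w ℕ.⊓ R → jump g′ v ≈ jump g′ w
        jump-cong {v} {w} eq with level (v ℕ.⊓ R) ℕ.≤? j | level (w ℕ.⊓ R) ℕ.≤? j
        ... | yes _ | yes _ = refl
        ... | no  _ | no  _ = reflexive (≡.cong (λ k → g′ (j ℕ.⊔ level k)) eq)
        ... | yes p | no ¬p = contradiction (≡.subst (λ k → level k ℕ.≤ j) eq p) ¬p
        ... | no ¬p | yes p = contradiction (≡.subst (λ k → level k ℕ.≤ j) (≡.sym eq) p) ¬p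

        jump-saturates : ∀ u → Saturates R (λ y → jump g′ (u ℕ.+ y))
        jump-saturates u i R≤i = jump-cong (≡.trans
          (ℕ.m≥n⇒m⊓n≡n (ℕ.≤-trans R≤i (ℕ.m≤n+m i u))) (≡.sym (ℕ.m≥n⇒m⊓n≡n (ℕ.m≤n+m R u))))

        -- Paths that do not jump are kept; at a jump the noise absorbs the
        -- difference of the two scores, which costs at most q ^ (m + m).
        𝔼-next-≤ : ∀ {u u′} → u′ ℕ.≤ u → u ℕ.≤ m ℕ.+ m ℕ.+ u′ →
                 q ^ cost j * 𝔼 (geometric R) (λ y → g (next j (u ℕ.+ y))) ≤
                 𝔼 (geometric R) (λ y → g′ (next j (u′ ℕ.+ y)))
        𝔼-next-≤ {u} {u′} u′≤u u≤2m+u′ = begin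
          q ^ cost j * 𝔼 d (λ y → g (next j (u ℕ.+ y)))
            ≈⟨ trans (*-congˡ (trans (𝔼-cong d (λ y → stay+jump g (u ℕ.+ y))) (𝔼-+ d _ _))) (distribˡ _ _ _) ⟩
          q ^ cost j * 𝔼 d (λ y → stay g (u ℕ.+ y)) + q ^ cost j * 𝔼 d (λ y → jump g (u ℕ.+ y))
            ≈⟨ +-cong (𝔼-*ˡ d _ _) (𝔼-*ˡ d _ _) ⟨
          𝔼 d (λ y → q ^ cost j * stay g (u ℕ.+ y)) + 𝔼 d (λ y → q ^ cost j * jump g (u ℕ.+ y))
            ≤⟨ +-mono-≤ (𝔼-mono-≤ d (λ y → stay-≤ (ℕ.+-monoˡ-≤ y u′≤u))) (𝔼-mono-≤ d (λ y → jump-≤ (u ℕ.+ y))) ⟩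
          𝔼 d (λ y → stay g′ (u′ ℕ.+ y)) + 𝔼 d (λ y → q ^ (m ℕ.+ m) * jump g′ (u ℕ.+ y))
            ≤⟨ +-mono-≤ ≤-refl jumps ⟩
          𝔼 d (λ y → stay g′ (u′ ℕ.+ y)) + 𝔼 d (λ y → jump g′ (u′ ℕ.+ y))
            ≈⟨ trans (𝔼-cong d (λ y → stay+jump g′ (u′ ℕ.+ y))) (𝔼-+ d _ _) ⟨
          𝔼 d (λ y → g′ (next j (u′ ℕ.+ y))) ∎
          where
          d = geometric R
          s = u ℕ.∸ u′

          s≤2m : s ℕ.≤ m ℕ.+ m
          s≤2m = ℕ.m≤n+o⇒m∸n≤o u u′ (≡.subst (u ℕ.≤_) (ℕ.+-comm (m ℕ.+ m) u′) u≤2m+u′)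

          jumps : 𝔼 d (λ y → q ^ (m ℕ.+ m) * jump g′ (u ℕ.+ y)) ≤ 𝔼 d (λ y → jump g′ (u′ ℕ.+ y))
          jumps = begin
            𝔼 d (λ y → q ^ (m ℕ.+ m) * jump g′ (u ℕ.+ y))
              ≈⟨ 𝔼-*ˡ d _ _ ⟩
            q ^ (m ℕ.+ m) * 𝔼 d (λ y → jump g′ (u ℕ.+ y))
              ≤⟨ *-monoʳ-≤ (𝔼-nonneg d (λ y → jump-nonneg (u ℕ.+ y))) (^-antimono-exponent 0≤q q≤1 s≤2m) ⟩
            q ^ s * 𝔼 d (λ y → jump g′ (u ℕ.+ y))
              ≈⟨ *-congˡ (𝔼-cong d (λ y → reflexive (≡.cong (jump g′)
                   (≡.trans (≡.cong (ℕ._+ y) (≡.sym (ℕ.m+[n∸m]≡n u′≤u))) (ℕ.+-assoc u′ s y))))) ⟩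
            q ^ s * 𝔼 d (λ y → jump g′ (u′ ℕ.+ (s ℕ.+ y)))
              ≤⟨ 𝔼-geometric-shift s R (jump-saturates u′) (λ y → jump-nonneg (u′ ℕ.+ y)) ⟩
            𝔼 d (λ y → jump g′ (u′ ℕ.+ y)) ∎

      infix 4 _≃_
      _≃_ : ℕ → ℕ → Set
      x ≃ x′ = x ℕ.≤ m ℕ.+ x′ × x′ ℕ.≤ m ℕ.+ x

      ℙ-trace : ∀ {T} → ℕ → ℕ → Vec ℕ T → Pred (Vec ℕ T) 0ℓ → ℝ
      ℙ-trace {T} z j xs S = ℙ (noises R T) (λ ys → S (trace z j xs ys))

      -- With threshold noise m + z for the second input, `x′ ∸ (m + z)` is at most `x ∸ z`
      -- whichever of the two scores is larger, so staying is preserved at every time. The price is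
      -- a gap of up to 2 m instead of m, to be bridged at jumps.
      ℙ-trace-≤ : ∀ {T} {xs xs′ : Vec ℕ T} → Pointwise _≃_ xs xs′ → ∀ z j S →
                  q ^ cost j * ℙ-trace z j xs S ≤ ℙ-trace (m ℕ.+ z) j xs′ S
      ℙ-trace-≤ [] z j S = begin
        q ^ cost j * 𝟙 (S [])  ≤⟨ *-monoʳ-≤ (0≤𝟙 _) (^-antimono-exponent 0≤q q≤1 {n = cost j} z≤n) ⟩
        1# * 𝟙 (S [])          ≈⟨ *-identityˡ _ ⟩
        𝟙 (S [])               ∎
      ℙ-trace-≤ {suc T} {x ∷ xs} {x′ ∷ xs′} ((x≤m+x′ , x′≤m+x) ∷ xs≃xs′) z j S = begin
        q ^ cost j * ℙ-trace z j (x ∷ xs) S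
          ≈⟨ *-congˡ (𝔼-noises-suc R T _) ⟩
        q ^ cost j * 𝔼 (geometric R) (λ y → g (next j (x ℕ.∸ z ℕ.+ y)))
          ≤⟨ Step.𝔼-next-≤ j g g′ (λ _ → ℙ-nonneg (noises R T) _) (λ _ → ℙ-nonneg (noises R T) _)
               (λ i _ → ℙ-trace-≤ xs≃xs′ z i (S ∘ (i ∷_))) u′≤u u≤2m+u′ ⟩
        𝔼 (geometric R) (λ y → g′ (next j (x′ ℕ.∸ (m ℕ.+ z) ℕ.+ y)))
          ≈⟨ 𝔼-noises-suc R T _ ⟨
        ℙ-trace (m ℕ.+ z) j (x′ ∷ xs′) S ∎
        where
        g g′ : ℕ → ℝ
        g  i = ℙ-trace z i xs (S ∘ (i ∷_))
        g′ i = ℙ-trace (m ℕ.+ z) i xs′ (S ∘ (i ∷_))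

        u′≤u : x′ ℕ.∸ (m ℕ.+ z) ℕ.≤ x ℕ.∸ z
        u′≤u = ℕ.≤-trans (ℕ.∸-monoˡ-≤ (m ℕ.+ z) x′≤m+x) (ℕ.≤-reflexive (ℕ.[m+n]∸[m+o]≡n∸o m x z))

        u≤2m+u′ : x ℕ.∸ z ℕ.≤ m ℕ.+ m ℕ.+ (x′ ℕ.∸ (m ℕ.+ z))
        u≤2m+u′ = ℕ.m≤n+o⇒m∸n≤o x z (ℕ.≤-trans x≤m+x′ (ℕ.≤-trans
          (ℕ.+-monoʳ-≤ m (ℕ.m≤n+m∸n x′ (m ℕ.+ z)))
          (ℕ.≤-reflexive (solve-ℕ m z (x′ ℕ.∸ (m ℕ.+ z))))))
          where
          solve-ℕ : ∀ m z w → m ℕ.+ (m ℕ.+ z ℕ.+ w) ≡ z ℕ.+ (m ℕ.+ m ℕ.+ w)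
          solve-ℕ m z w = ℕ-Solver.solve 3 (λ m z w → m ℕ-Solver.:+ (m ℕ-Solver.:+ z ℕ-Solver.:+ w)
            ℕ-Solver.:= z ℕ-Solver.:+ (m ℕ-Solver.:+ m ℕ-Solver.:+ w)) ≡.refl m z w

      coins : ∀ T → Dist (ℕ × Vec ℕ T)
      coins T = geometric R ⊗ noises R T

      -- Threshold noise from R on reduces every score to 0. This is the saturation that
      -- `𝔼-geometric-shift` asks for when the threshold noise is shifted by m.
      trace-saturated : ∀ {T} {xs : Vec ℕ T} → All (ℕ._≤ R) xs → ∀ {z} → R ℕ.≤ z → ∀ j ys →
                        trace z j xs ys ≡ trace R j xs ys
      trace-saturated []             R≤z j []       = ≡.refl
      trace-saturated {xs = x ∷ xs} (x≤R ∷ xs≤R) {z} R≤z j (y ∷ ys)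
        rewrite ℕ.m≤n⇒m∸n≡0 (ℕ.≤-trans x≤R R≤z) | ℕ.m≤n⇒m∸n≡0 x≤R =
        ≡.cong (_ ∷_) (trace-saturated xs≤R R≤z _ ys)

      ℙ-coins-≤ : ∀ {T} {xs xs′ : Vec ℕ T} → Pointwise _≃_ xs xs′ → All (ℕ._≤ R) xs′ → ∀ S →
                  q ^ (m ℕ.+ cost 0) * ℙ (coins T) (λ (z , ys) → S (trace z 0 xs ys)) ≤
                  ℙ (coins T) (λ (z , ys) → S (trace z 0 xs′ ys))
      ℙ-coins-≤ {T} {xs} {xs′} xs≃xs′ xs′≤R S = begin
        q ^ (m ℕ.+ cost 0) * ℙ (coins T) (λ (z , ys) → S (trace z 0 xs ys))
          ≈⟨ *-cong (^-homo-* q m (cost 0)) (𝔼-⊗ (geometric R) (noises R T) _) ⟩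
        q ^ m * q ^ cost 0 * 𝔼 (geometric R) (λ z → ℙ-trace z 0 xs S)
          ≈⟨ trans (*-assoc _ _ _) (*-congˡ (sym (𝔼-*ˡ (geometric R) _ _))) ⟩
        q ^ m * 𝔼 (geometric R) (λ z → q ^ cost 0 * ℙ-trace z 0 xs S)
          ≤⟨ *-monoˡ-≤ (^-nonneg 0≤q m) (𝔼-mono-≤ (geometric R) (λ z → ℙ-trace-≤ xs≃xs′ z 0 S)) ⟩
        q ^ m * 𝔼 (geometric R) (λ z → ℙ-trace (m ℕ.+ z) 0 xs′ S)
          ≤⟨ 𝔼-geometric-shift m R
               (λ z R≤z → 𝔼-cong (noises R T) (λ ys → reflexive (≡.cong (𝟙 ∘ S) (trace-saturated xs′≤R R≤z 0 ys))))
               (λ z → ℙ-nonneg (noises R T) _) ⟩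
        𝔼 (geometric R) (λ z → ℙ-trace z 0 xs′ S)
          ≈⟨ 𝔼-⊗ (geometric R) (noises R T) _ ⟨
        ℙ (coins T) (λ (z , ys) → S (trace z 0 xs′ ys)) ∎

      Quiet : ∀ {T} → ℕ → Pred (ℕ × Vec ℕ T) 0ℓ
      Quiet i (z , ys) = z ℕ.≤ i × All (ℕ._≤ i) ys

      -- A union bound over T + 1 noises: one for the threshold and one for each time step.
      ℙ-Quiet : ∀ i T → 1# - fromℕ (suc T) * q ^ i ≤ ℙ (coins T) (Quiet i)
      ℙ-Quiet i T = ≤-by (ℙ (coins T) (Quiet i) + ℙ (coins T) (λ ω → ¬ Quiet i ω) - 1#
                          + (fromℕ (suc T) * q ^ i - ℙ (coins T) (λ ω → ¬ Quiet i ω)))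
        (+-nonneg (x≤y⇒0≤y-x (ℙ-complement (coins T) (Quiet i))) (x≤y⇒0≤y-x loud))
        (solve 3 (λ a b c → a := :1 :- c :+ (a :+ b :- :1 :+ (c :- b))) refl
          (ℙ (coins T) (Quiet i)) (ℙ (coins T) (λ ω → ¬ Quiet i ω)) (fromℕ (suc T) * q ^ i))
        where
        split : ∀ z (ys : Vec ℕ T) → ¬ Quiet i (z , ys) → i ℕ.< z ⊎ ¬ All (ℕ._≤ i) ys
        split z ys loud with z ℕ.≤? i
        ... | yes z≤i = inj₂ λ all → loud (z≤i , all)
        ... | no  z≰i = inj₁ (ℕ.≰⇒> z≰i)

        loud : ℙ (coins T) (λ ω → ¬ Quiet i ω) ≤ fromℕ (suc T) * q ^ i
        loud = begin
          ℙ (coins T) (λ ω → ¬ Quiet i ω)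
            ≤⟨ ℙ-⊗-∪ (geometric R) (noises R T) split ⟩
          ℙ (geometric R) (i ℕ.<_) + ℙ (noises R T) (λ ys → ¬ All (ℕ._≤ i) ys)
            ≤⟨ +-mono-≤ (geometric-tail i R) (noises-tail i R T) ⟩
          q ^ i + fromℕ T * q ^ i
            ≈⟨ solve 2 (λ p t → p :+ t :* p := (:1 :+ t) :* p) refl (q ^ i) (fromℕ T) ⟩
          fromℕ (suc T) * q ^ i ∎

      Increasing : ∀ {T} → Vec ℕ T → Set
      Increasing xs = ∀ {s t} → s Fin.≤ t → lookup xs s ℕ.≤ lookup xs t

      -- The state is raised at once, so only the current score and the threshold noise can hold it
      -- down. The cut-off at R is harmless for scores up to R.
      trace-≥ : ∀ {T i z} → z ℕ.≤ i → ∀ {xs : Vec ℕ T} → All (ℕ._≤ R) xs → ∀ j ys t →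
                level (lookup xs t ℕ.∸ i) ℕ.≤ lookup (trace z j xs ys) t
      trace-≥ {i = i} {z} z≤i {x ∷ xs} (x≤R ∷ xs≤R) j (y ∷ ys) zero = ℕ.≤-trans
        (level-mono (ℕ.⊓-glb (ℕ.≤-trans (ℕ.∸-monoʳ-≤ x z≤i) (ℕ.m≤m+n _ y)) (ℕ.≤-trans (ℕ.m∸n≤m x i) x≤R)))
        (ℕ.m≤n⊔m j _)
      trace-≥ z≤i (x≤R ∷ xs≤R) j (y ∷ ys) (suc t) = trace-≥ z≤i xs≤R _ ys t

      -- An earlier jump reached at most the level of an earlier score plus i, and in an increasing
      -- sequence that is at most the level of the current score plus i.
      trace-≤ : ∀ {T i} z (xs : Vec ℕ T) → Increasing xs → ∀ j {ys} → All (ℕ._≤ i) ys → ∀ t →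
                lookup (trace z j xs ys) t ℕ.≤ j ℕ.⊔ level (lookup xs t ℕ.+ i)
      trace-≤ {i = i} z (x ∷ xs) incr j {y ∷ ys} (y≤i ∷ ys≤i) t = go t
        where
        first : next j (x ℕ.∸ z ℕ.+ y) ℕ.≤ j ℕ.⊔ level (x ℕ.+ i)
        first = ℕ.⊔-monoʳ-≤ j (level-mono (ℕ.≤-trans (ℕ.m⊓n≤m _ R) (ℕ.+-mono-≤ (ℕ.m∸n≤m x z) y≤i)))

        go : ∀ t → lookup (trace z j (x ∷ xs) (y ∷ ys)) t ℕ.≤ j ℕ.⊔ level (lookup (x ∷ xs) t ℕ.+ i)
        go zero    = first
        go (suc t) = ℕ.≤-trans (trace-≤ z xs (λ s≤t → incr (s≤s s≤t)) _ ys≤i t)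
          (ℕ.⊔-lub (ℕ.≤-trans first (ℕ.⊔-monoʳ-≤ j (level-mono (ℕ.+-monoˡ-≤ i (incr {Fin.zero} {Fin.suc t} z≤n)))))
                   (ℕ.m≤n⊔m j _))

      -- The mechanism as a dynamic algorithm.

      module _ {Data : Set} (score : Data → ℕ) (output : ℕ → ℝ) where

        -- The state after a prefix of the input, since an answer may see no more than that. The
        -- noise vector always has full length T; the clause with data but no noise is a dummy that
        -- prefixes never reach.
        final : ∀ {n T} → ℕ → ℕ → Vec Data n → Vec ℕ T → ℕ
        final z j []       ys       = j
        final z j (G ∷ Gs) []       = j
        final z j (G ∷ Gs) (y ∷ ys) = final z (next j (score G ℕ.∸ z ℕ.+ y)) Gs ys

        final-truncate : ∀ {T} z j (Gs : Vec Data T) ys t →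
          final z j (truncate (toℕ<n t) Gs) ys ≡ lookup (trace z j (Vec.map score Gs) ys) t
        final-truncate z j (G ∷ Gs) (y ∷ ys) zero    = ≡.refl
        final-truncate z j (G ∷ Gs) (y ∷ ys) (suc t) = final-truncate z _ Gs ys t

        algorithm : ∀ T → DynamicAlgorithm Data T
        algorithm T = record
          { coins      = finiteSpace (coins T)
          ; answer     = λ t Gs (z , ys) → output (final z 0 Gs ys)
          ; measurable = λ _ _ _ → lift tt
          }

        module _ (score≤R : ∀ G → score G ℕ.≤ R) where

          scores≤R : ∀ {T} (Gs : Vec Data T) → All (ℕ._≤ R) (Vec.map score Gs)
          scores≤R []       = []
          scores≤R (G ∷ Gs) = score≤R G ∷ scores≤R Gs

          scores-≃ : ∀ {T} (Gs Gs′ : Vec Data T) → (∀ t → score (lookup Gs t) ≃ score (lookup Gs′ t)) →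
                     Pointwise _≃_ (Vec.map score Gs) (Vec.map score Gs′)
          scores-≃ []       []         close = []
          scores-≃ (G ∷ Gs) (G′ ∷ Gs′) close = close Fin.zero ∷ scores-≃ Gs Gs′ (close ∘ Fin.suc)

          algorithm-private : ∀ {T} (Gs Gs′ : Vec Data T) →
            (∀ t → score (lookup Gs t) ≃ score (lookup Gs′ t)) → ∀ {S} → Borel S →
            let open DynamicAlgorithm (algorithm T) in
            q ^ (m ℕ.+ cost 0) * Pr (S ∘ outputs Gs) ≤ Pr (S ∘ outputs Gs′)
          algorithm-private {T} Gs Gs′ close {S} borel = begin
            q ^ (m ℕ.+ cost 0) * ℙ (coins T) (S ∘ outputs Gs)
              ≤⟨ *-monoˡ-≤ (^-nonneg 0≤q (m ℕ.+ cost 0)) (ℙ-mono-≤ (coins T) λ (z , ys) →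
                   borel-resp borel λ t → reflexive (≡.cong output (final-truncate z 0 Gs ys t))) ⟩
            q ^ (m ℕ.+ cost 0) * ℙ (coins T) (λ (z , ys) → S′ (trace z 0 (Vec.map score Gs) ys))
              ≤⟨ ℙ-coins-≤ (scores-≃ Gs Gs′ close) (scores≤R Gs′) S′ ⟩
            ℙ (coins T) (λ (z , ys) → S′ (trace z 0 (Vec.map score Gs′) ys))
              ≤⟨ (ℙ-mono-≤ (coins T) λ (z , ys) →
                   borel-resp borel λ t → reflexive (≡.cong output (≡.sym (final-truncate z 0 Gs′ ys t)))) ⟩
            ℙ (coins T) (S ∘ outputs Gs′) ∎
            where
            open DynamicAlgorithm (algorithm T) using (outputs)
            S′ : Pred (Vec ℕ T) 0ℓ
            S′ js = S (λ t → output (lookup js t))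

          algorithm-accurate : ∀ {T} i (Gs : Vec Data T) →
            (∀ {s t} → s Fin.≤ t → score (lookup Gs s) ℕ.≤ score (lookup Gs t)) →
            ∀ (Accurate : Fin T → Pred ℝ 0ℓ) →
            (∀ t j → level (score (lookup Gs t) ℕ.∸ i) ℕ.≤ j → j ℕ.≤ level (score (lookup Gs t) ℕ.+ i) →
               Accurate t (output j)) →
            let open DynamicAlgorithm (algorithm T) in
            1# - fromℕ (suc T) * q ^ i ≤ Pr (λ ω → ∀ t → Accurate t (outputs Gs ω t))
          algorithm-accurate {T} i Gs incr Accurate accurate = ≤-trans (ℙ-Quiet i T)
            (ℙ-mono-≤ (coins T) λ (z , ys) (z≤i , ys≤i) t →
              ≡.subst (Accurate t ∘ output) (≡.sym (final-truncate z 0 Gs ys t)) (accurate t _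
                (≡.subst (λ x → level (x ℕ.∸ i) ℕ.≤ lookup (trace z 0 xs ys) t) (lookup-map t score Gs)
                  (trace-≥ z≤i (scores≤R Gs) 0 ys t))
                (≡.subst (λ x → lookup (trace z 0 xs ys) t ℕ.≤ level (x ℕ.+ i)) (lookup-map t score Gs)
                  (trace-≤ z xs xs-incr 0 ys≤i t))))
            where
            xs = Vec.map score Gs
            xs-incr : Increasing xs
            xs-incr {s} {t} s≤t rewrite lookup-map s score Gs | lookup-map t score Gs = incr s≤t

  open Mechanism

  -- Choice of parameters and application to monotone functions.

  module Monotone where

    module _ (P : ℕ → Set) where

      greatest : ℕ → ℕ
      greatest zero    = 0
      greatest (suc n) with em {P (suc n)}
      ... | yes _ = suc n
      ... | no  _ = greatest n

      greatest-≤ : ∀ n → greatest n ℕ.≤ n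
      greatest-≤ zero    = z≤n
      greatest-≤ (suc n) with em {P (suc n)}
      ... | yes _ = ℕ.≤-refl
      ... | no  _ = ℕ.m≤n⇒m≤1+n (greatest-≤ n)

      greatest-holds : ∀ n → greatest n ≡ 0 ⊎ P (greatest n)
      greatest-holds zero    = inj₁ ≡.refl
      greatest-holds (suc n) with em {P (suc n)}
      ... | yes p = inj₂ p
      ... | no  _ = greatest-holds n

      greatest-maximal : ∀ n {k} → k ℕ.≤ n → P k → k ℕ.≤ greatest n
      greatest-maximal zero    z≤n p = z≤n
      greatest-maximal (suc n) k≤1+n p with em {P (suc n)}
      ... | yes _  = k≤1+n
      ... | no ¬p with ℕ.m≤n⇒m<n∨m≡n k≤1+n
      ...   | inj₁ k<1+n  = greatest-maximal n (ℕ.s≤s⁻¹ k<1+n) p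
      ...   | inj₂ ≡.refl = contradiction p ¬p

    greatest-mono : ∀ {P Q : ℕ → Set} → (∀ {k} → P k → Q k) → ∀ n → greatest P n ℕ.≤ greatest Q n
    greatest-mono {P} {Q} P⊆Q n with greatest-holds P n
    ... | inj₁ ≡0 = ≡.subst (ℕ._≤ greatest Q n) (≡.sym ≡0) z≤n
    ... | inj₂ p  = greatest-maximal Q n (greatest-≤ P n) (P⊆Q p)

    module Deterministic {Data : Set} (g : Data → ℝ) where

      algorithm : ∀ T → DynamicAlgorithm Data T
      algorithm T = record
        { coins      = finiteSpace (ret tt)
        ; answer     = λ t Gs _ → g (last Gs)
        ; measurable = λ _ _ _ → lift tt
        }

      last-truncate : ∀ {T} (Gs : Vec Data T) t → last (truncate (toℕ<n t) Gs) ≡ lookup Gs t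
      last-truncate (G ∷ Gs)      zero    = ≡.refl
      last-truncate (G ∷ G′ ∷ Gs) (suc t) = last-truncate (G′ ∷ Gs) t

    -- m is the sensitivity in grid cells, K bounds the number of jumps of the
    -- output, and i bounds all noises, in grid cells, with probability 1 - δ.
    record Calibration (ε b r ρ α δ : ℝ) (T : ℕ) : Set where
      field
        m K i        : ℕ
        grid q       : ℝ
        0<grid       : 0# < grid
        grid*m≈ρ     : grid * fromℕ m ≈ ρ
        r≤b^[1+K]    : r ≤ b ^ suc K
        0≤q          : 0# ≤ q
        q≤1          : q ≤ 1#
        q^-exp       : ∀ {x y} → q ^ (m ℕ.+ K ℕ.* (m ℕ.+ m)) * x ≤ y → x ≤ exp ε * y
        failure-≤    : fromℕ (suc T) * q ^ i ≤ δ
        error-≤      : grid * fromℕ (suc (i ℕ.+ i)) ≤ α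

    -- The factor 3 comes from L + 2 K L ≤ 3 A in `grid-error-≤`, the rest from the bound on the
    -- noise. As the constant may depend on δ, the term 1 / δ can replace log (1 / δ); it has the
    -- advantage of being positive for every δ.
    errorConstant : ℝ → ℝ
    errorConstant δ = fromℕ 3 * (fromℕ 10 + fromℕ 4 * (1# / δ))

    errorConstant-pos : ∀ {δ} → 0# < δ → 0# < errorConstant δ
    errorConstant-pos 0<δ =
      *-pos (0<fromℕ 3) (+-pos-nonneg (0<fromℕ 10) (*-nonneg (0≤fromℕ 4) (proj₁ (/-pos 0<1 0<δ))))

    -- Choice of the noise and of its bound.

    module CalibrateNoise {ε δ : ℝ} (0<ε : 0# < ε) (0<δ : 0# < δ) (T : ℕ) (2≤T : 2 ℕ.≤ T)
      (N : ℕ) (0<N : 0# < fromℕ N) (ε≤N : ε ≤ fromℕ N) where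

      Λ D θ q : ℝ
      Λ = log (fromℕ T)
      D = 1# / δ
      θ = ε / fromℕ N
      -- An inverse and not `exp (- θ)`, because the laws of `exp` are established for nonnegative
      -- arguments.
      q = exp θ ⁻¹

      0<D : 0# < D
      0<D = /-pos 0<1 0<δ

      1≤T : 1# ≤ fromℕ T
      1≤T = ≤-trans (≤-reflexive (sym (+-identityʳ 1#))) (fromℕ-mono-≤ {1} (ℕ.≤-trans (s≤s z≤n) 2≤T))

      0≤Λ : 0# ≤ Λ
      0≤Λ = proj₁ (log-inverse 1≤T)

      expΛ≈T : exp Λ ≈ fromℕ T
      expΛ≈T = proj₂ (log-inverse 1≤T)

      -- In effect log 2 ≥ 1/2: as exp Λ = T ≥ 2, `exp[x]*[1-x]≤1` gives 2 (1 - Λ) ≤ 1. It lets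
      -- constants be absorbed into log T.
      1≤2Λ : 1# ≤ Λ + Λ
      1≤2Λ with total 1# Λ
      ... | inj₁ 1≤Λ = ≤-trans 1≤Λ (≤-by Λ 0≤Λ refl)
      ... | inj₂ Λ≤1 = ≤-by (1# - fromℕ 2 * (1# - Λ)) (x≤y⇒0≤y-x (begin
          fromℕ 2 * (1# - Λ)   ≤⟨ *-monoʳ-≤ (x≤y⇒0≤y-x Λ≤1) (fromℕ-mono-≤ 2≤T) ⟩
          fromℕ T * (1# - Λ)   ≈⟨ *-congʳ expΛ≈T ⟨
          exp Λ * (1# - Λ)     ≤⟨ exp[x]*[1-x]≤1 0≤Λ ⟩
          1#                   ∎))
        (solve 1 (λ l → l :+ l := :1 :+ (:1 :- (:1 :+ (:1 :+ :0)) :* (:1 :- l))) refl Λ)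

      0<θ : 0# < θ
      0<θ = /-pos 0<ε 0<N

      0≤θ : 0# ≤ θ
      0≤θ = proj₁ 0<θ

      θ*N≈ε : θ * fromℕ N ≈ ε
      θ*N≈ε = x/y*y≈x 0<N

      θ≤1 : θ ≤ 1#
      θ≤1 = *-cancelˡ-≤ 0<N (begin
        fromℕ N * θ   ≈⟨ trans (*-comm _ _) θ*N≈ε ⟩
        ε             ≤⟨ ε≤N ⟩
        fromℕ N       ≈⟨ *-identityʳ _ ⟨
        fromℕ N * 1#  ∎)

      0<expθ : 0# < exp θ
      0<expθ = 0<exp 0≤θ

      0≤q : 0# ≤ q
      0≤q = proj₁ (x⁻¹-pos 0<expθ)

      q≤1 : q ≤ 1#
      q≤1 = begin
        q          ≈⟨ *-identityʳ q ⟨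
        q * 1#     ≤⟨ *-monoˡ-≤ 0≤q (1≤exp 0≤θ) ⟩
        q * exp θ  ≈⟨ x⁻¹*x≈1 0<expθ ⟩
        1#         ∎

      exp[nθ]*q^n≈1 : ∀ n → exp (fromℕ n * θ) * q ^ n ≈ 1#
      exp[nθ]*q^n≈1 n = trans (*-congʳ (exp-ℕ* 0≤θ n)) (powers n)
        where
        powers : ∀ n → exp θ ^ n * q ^ n ≈ 1#
        powers zero    = *-identityˡ 1#
        powers (suc n) = begin-equality
          exp θ * exp θ ^ n * (q * q ^ n)      ≈⟨ solve 4 (λ e s q t → e :* s :* (q :* t) := e :* q :* (s :* t)) refl
                                                    (exp θ) (exp θ ^ n) q (q ^ n) ⟩
          exp θ * q * (exp θ ^ n * q ^ n)      ≈⟨ *-cong (*-inverseʳ (<⇒≉˘ 0<expθ)) (powers n) ⟩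
          1# * 1#                              ≈⟨ *-identityˡ 1# ⟩
          1#                                   ∎

      -- N θ = ε makes exp ε the inverse of `q ^ N`. Up to here the privacy loss is carried as a
      -- power of q on the left-hand side.
      q^-exp : ∀ {x y} → q ^ N * x ≤ y → x ≤ exp ε * y
      q^-exp {x} {y} q^N*x≤y = begin
        x                                 ≈⟨ *-identityˡ x ⟨
        1# * x                            ≈⟨ *-congʳ (exp[nθ]*q^n≈1 N) ⟨
        exp (fromℕ N * θ) * q ^ N * x     ≈⟨ *-assoc _ _ _ ⟩
        exp (fromℕ N * θ) * (q ^ N * x)   ≤⟨ *-monoˡ-≤ (exp-nonneg 0≤Nθ) q^N*x≤y ⟩
        exp (fromℕ N * θ) * y             ≈⟨ *-congʳ (exp-cong 0≤Nθ (trans (*-comm _ _) θ*N≈ε)) ⟩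
        exp ε * y                         ∎
        where 0≤Nθ = *-nonneg (0≤fromℕ N) 0≤θ

      0≤2Λ+D : 0# ≤ Λ + Λ + D
      0≤2Λ+D = +-nonneg (+-nonneg 0≤Λ 0≤Λ) (proj₁ 0<D)

      -- The bound i on the noises is the least number with i θ > 2 Λ + D. Then exp (i θ) exceeds T²
      -- / δ, because exp D ≥ D, and T² ≥ T + 1 covers the number of noises.
      i-floor : ∃ λ n → fromℕ n * θ ≤ Λ + Λ + D × Λ + Λ + D < fromℕ (suc n) * θ
      i-floor = floor 0<θ 0≤2Λ+D

      i₀ i : ℕ
      i₀ = proj₁ i-floor
      i  = suc i₀

      failure-≤ : fromℕ (suc T) * q ^ i ≤ δ
      failure-≤ = begin
        fromℕ (suc T) * q ^ i                 ≤⟨ *-monoʳ-≤ (^-nonneg 0≤q i) T+1≤ ⟩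
        δ * exp (fromℕ i * θ) * q ^ i         ≈⟨ trans (*-assoc _ _ _) (*-congˡ (exp[nθ]*q^n≈1 i)) ⟩
        δ * 1#                                ≈⟨ *-identityʳ δ ⟩
        δ                                     ∎
        where
        T+1≤ : fromℕ (suc T) ≤ δ * exp (fromℕ i * θ)
        T+1≤ = begin
          fromℕ (suc T)              ≤⟨ fromℕ-mono-≤ {suc T} {T ℕ.* T} (ℕ.≤-trans
                                          (ℕ.+-mono-≤ (ℕ.≤-trans (s≤s z≤n) 2≤T) (ℕ.m≤m+n T 0)) (ℕ.*-monoˡ-≤ T 2≤T)) ⟩
          fromℕ (T ℕ.* T)            ≈⟨ fromℕ-* T T ⟩
          fromℕ T * fromℕ T          ≈⟨ *-identityˡ _ ⟨
          1# * (fromℕ T * fromℕ T)   ≈⟨ *-congʳ (x/y*y≈x 0<δ) ⟨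
          D * δ * (fromℕ T * fromℕ T)
                                     ≈⟨ solve 3 (λ D δ t → D :* δ :* t := δ :* (t :* D)) refl D δ (fromℕ T * fromℕ T) ⟩
          δ * (fromℕ T * fromℕ T * D)
            ≤⟨ *-monoˡ-≤ (proj₁ 0<δ) (*-monoˡ-≤ (*-nonneg (0≤fromℕ T) (0≤fromℕ T))
                 (≤-trans (≤-by 1# 0≤1 (+-comm _ _)) (1+x≤exp (proj₁ 0<D)))) ⟩
          δ * (fromℕ T * fromℕ T * exp D)
            ≈⟨ *-congˡ (trans (exp-+ (+-nonneg 0≤Λ 0≤Λ) (proj₁ 0<D))
                 (*-congʳ (trans (exp-+ 0≤Λ 0≤Λ) (*-cong expΛ≈T expΛ≈T)))) ⟨
          δ * exp (Λ + Λ + D)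
            ≤⟨ *-monoˡ-≤ (proj₁ 0<δ) (exp-mono-≤ 0≤2Λ+D (proj₁ (proj₂ (proj₂ i-floor)))) ⟩
          δ * exp (fromℕ i * θ)      ∎

      -- As i = i₀ + 1, θ (2 i + 1) = 2 i₀ θ + 3 θ ≤ 2 (2 Λ + D) + 6 Λ, by θ ≤ 1 ≤ 2 Λ. Finally 2 D
      -- ≤ 4 D Λ, again by 1 ≤ 2 Λ; hence 10 and 4.
      error-≤ : ε * fromℕ (suc (i ℕ.+ i)) ≤ fromℕ N * ((fromℕ 10 + fromℕ 4 * D) * Λ)
      error-≤ = begin
        ε * fromℕ (suc (i ℕ.+ i))
          ≈⟨ *-cong (sym θ*N≈ε) (+-congˡ (fromℕ-+ i i)) ⟩
        θ * fromℕ N * (1# + (1# + i′ + (1# + i′)))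
          ≈⟨ solve 3 (λ θ n i → θ :* n :* (:1 :+ (:1 :+ i :+ (:1 :+ i))) :=
               n :* (i :* θ :+ i :* θ :+ (θ :+ θ :+ θ))) refl θ (fromℕ N) i′ ⟩
        fromℕ N * (i′ * θ + i′ * θ + (θ + θ + θ))
          ≤⟨ *-monoˡ-≤ (0≤fromℕ N) (+-mono-≤ (+-mono-≤ i′θ≤ i′θ≤) (+-mono-≤ (+-mono-≤ θ≤2Λ θ≤2Λ) θ≤2Λ)) ⟩
        fromℕ N * ((Λ + Λ + D) + (Λ + Λ + D) + (Λ + Λ + (Λ + Λ) + (Λ + Λ)))
          ≤⟨ *-monoˡ-≤ (0≤fromℕ N) (≤-by (fromℕ 2 * (D * (Λ + Λ - 1#)))
               (*-nonneg (0≤fromℕ 2) (*-nonneg (proj₁ 0<D) (x≤y⇒0≤y-x 1≤2Λ)))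
               (solve 2 (λ Λ D →
                 (num 10 :+ num 4 :* D) :* Λ :=
                 (Λ :+ Λ :+ D) :+ (Λ :+ Λ :+ D) :+ (Λ :+ Λ :+ (Λ :+ Λ) :+ (Λ :+ Λ))
                 :+ num 2 :* (D :* (Λ :+ Λ :- :1))) refl Λ D)) ⟩
        fromℕ N * ((fromℕ 10 + fromℕ 4 * D) * Λ) ∎
        where
        i′ : ℝ
        i′ = fromℕ i₀

        i′θ≤ : i′ * θ ≤ Λ + Λ + D
        i′θ≤ = proj₁ (proj₂ i-floor)

        θ≤2Λ : θ ≤ Λ + Λ
        θ≤2Λ = ≤-trans θ≤1 1≤2Λ

        -- Follows the recursion of `fromℕ`, so that the numerals of the solver evaluate to `fromℕ`
        -- by computation.
        num : ∀ {n} → ℕ → Polynomial n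
        num zero    = :0
        num (suc n) = :1 :+ num n

    module Calibrate {ε β r δ : ℝ} (0<ε : 0# < ε) (0<β : 0# < β) (1≤r : 1# ≤ r) (0<δ : 0# < δ)
      (T : ℕ) (2≤T : 2 ℕ.≤ T) where

      L A c : ℝ
      L = log (1# + β)
      A = log r
      c = fromℕ 10 + fromℕ 4 * (1# / δ)

      α : ℝ → ℝ
      α ρ = errorConstant δ * ((ρ * A * log (fromℕ T)) / (ε * L))

      1≤1+β : 1# ≤ 1# + β
      1≤1+β = ≤-by β (proj₁ 0<β) refl

      0≤A : 0# ≤ A
      0≤A = proj₁ (log-inverse 1≤r)

      0≤L : 0# ≤ L
      0≤L = proj₁ (log-inverse 1≤1+β)

      expA≈r : exp A ≈ r
      expA≈r = proj₂ (log-inverse 1≤r)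

      expL≈1+β : exp L ≈ 1# + β
      expL≈1+β = proj₂ (log-inverse 1≤1+β)

      0≤Λ : 0# ≤ log (fromℕ T)
      0≤Λ = proj₁ (log-inverse (≤-trans (≤-reflexive (sym (+-identityʳ 1#)))
        (fromℕ-mono-≤ {1} (ℕ.≤-trans (s≤s z≤n) 2≤T))))

      0<L : 0# < L
      0<L = ≰⇒> λ L≤0 → <⇒≱ 0<β (+-cancelʳ-≤ 1# (begin
        β + 1#   ≈⟨ +-comm _ _ ⟩
        1# + β   ≈⟨ expL≈1+β ⟨
        exp L    ≤⟨ exp-mono-≤ 0≤L L≤0 ⟩
        exp 0#   ≈⟨ exp-0 ⟩
        1#       ≈⟨ +-identityˡ 1# ⟨
        0# + 1#  ∎))

      0<εL : 0# < ε * L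
      0<εL = *-pos 0<ε 0<L

      α-nonneg : ∀ {ρ} → 0# ≤ ρ → 0# ≤ α ρ
      α-nonneg 0≤ρ = *-nonneg (proj₁ (errorConstant-pos 0<δ)) (/-nonneg (*-nonneg (*-nonneg 0≤ρ 0≤A) 0≤Λ) 0<εL)

      module Resolution {ρ : ℝ} (0<ρ : 0# < ρ) (L≤A : L ≤ A)
        (m K : ℕ) (0<m : 0# < fromℕ m) (ε≤m : ε ≤ fromℕ m)
        (KL≤A : fromℕ K * L ≤ A) (A≤[1+K]L : A ≤ fromℕ (suc K) * L) where

        N : ℕ
        N = m ℕ.+ K ℕ.* (m ℕ.+ m)

        m≤N : fromℕ m ≤ fromℕ N
        m≤N = fromℕ-mono-≤ (ℕ.m≤m+n m _)

        open CalibrateNoise {ε} {δ} 0<ε 0<δ T 2≤T N (<-≤-trans 0<m m≤N) (≤-trans ε≤m m≤N)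
          using (q; i; 0≤q; q≤1; q^-exp; failure-≤; error-≤)

        grid : ℝ
        grid = ρ / fromℕ m

        0<grid : 0# < grid
        0<grid = /-pos 0<ρ 0<m

        grid*m≈ρ : grid * fromℕ m ≈ ρ
        grid*m≈ρ = x/y*y≈x 0<m

        r≤b^[1+K] : r ≤ (1# + β) ^ suc K
        r≤b^[1+K] = begin
          r                       ≈⟨ expA≈r ⟨
          exp A                   ≤⟨ exp-mono-≤ 0≤A A≤[1+K]L ⟩
          exp (fromℕ (suc K) * L) ≈⟨ exp-ℕ* 0≤L (suc K) ⟩
          exp L ^ suc K           ≈⟨ ^-congˡ (suc K) expL≈1+β ⟩
          (1# + β) ^ suc K        ∎

        -- The resolution m cancels: grid N = ρ (1 + 2 K). Multiplied by L, the factor 1 + 2 K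
        -- becomes L + 2 K L ≤ 3 A, where K L ≤ A is the choice of K and the single L needs L ≤ A,
        -- that is, 1 + β ≤ r.
        grid-error-≤ : grid * fromℕ (suc (i ℕ.+ i)) ≤ α ρ
        grid-error-≤ = *-cancelˡ-≤ 0<εL (begin
          ε * L * (grid * I)
            ≈⟨ solve 4 (λ ε L g I → ε :* L :* (g :* I) := g :* L :* (ε :* I)) refl ε L grid I ⟩
          grid * L * (ε * I)
            ≤⟨ *-monoˡ-≤ (*-nonneg (proj₁ 0<grid) 0≤L) error-≤ ⟩
          grid * L * (fromℕ N * (c * Λ))
            ≈⟨ *-congˡ (*-congʳ (trans (fromℕ-+ m _)
                 (+-congˡ (trans (fromℕ-* K (m ℕ.+ m)) (*-congˡ (fromℕ-+ m m)))))) ⟩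
          grid * L * ((M + k * (M + M)) * (c * Λ))
            ≈⟨ solve 5 (λ M k L g u → g :* L :* ((M :+ k :* (M :+ M)) :* u) :=
                 g :* M :* (u :* (L :+ (k :* L :+ k :* L)))) refl M k L grid (c * Λ) ⟩
          grid * M * (c * Λ * (L + (k * L + k * L)))
            ≤⟨ *-mono-≤ (*-nonneg (proj₁ 0<grid) (proj₁ 0<m)) (*-nonneg 0≤cΛ 0≤V) (≤-reflexive grid*m≈ρ)
                 (*-monoˡ-≤ 0≤cΛ (+-mono-≤ L≤A (+-mono-≤ KL≤A KL≤A))) ⟩
          ρ * (c * Λ * (A + (A + A)))
            ≈⟨ solve 4 (λ ρ c Λ A → ρ :* (c :* Λ :* (A :+ (A :+ A))) :=
                 (:1 :+ (:1 :+ (:1 :+ :0))) :* c :* (ρ :* A :* Λ)) refl ρ c Λ A ⟩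
          errorConstant δ * (ρ * A * Λ)
            ≈⟨ *-congˡ (x/y*y≈x 0<εL) ⟨
          errorConstant δ * ((ρ * A * Λ) / (ε * L) * (ε * L))
            ≈⟨ solve 3 (λ C X Y → C :* (X :* Y) := Y :* (C :* X)) refl
                 (errorConstant δ) ((ρ * A * Λ) / (ε * L)) (ε * L) ⟩
          ε * L * α ρ ∎)
          where
          I M k Λ : ℝ
          I = fromℕ (suc (i ℕ.+ i))
          M = fromℕ m
          k = fromℕ K
          Λ = log (fromℕ T)

          0≤kL : 0# ≤ k * L
          0≤kL = *-nonneg (0≤fromℕ K) 0≤L

          0≤V : 0# ≤ L + (k * L + k * L)
          0≤V = +-nonneg 0≤L (+-nonneg 0≤kL 0≤kL)

          0≤cΛ : 0# ≤ c * Λ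
          0≤cΛ = *-nonneg (+-nonneg (0≤fromℕ 10) (*-nonneg (0≤fromℕ 4) (proj₁ (/-pos 0<1 0<δ)))) 0≤Λ

        resolution : Calibration ε (1# + β) r ρ (α ρ) δ T
        resolution = record
          { m         = m
          ; K         = K
          ; i         = i
          ; grid      = grid
          ; q         = q
          ; 0<grid    = 0<grid
          ; grid*m≈ρ  = grid*m≈ρ
          ; r≤b^[1+K] = r≤b^[1+K]
          ; 0≤q       = 0≤q
          ; q≤1       = q≤1
          ; q^-exp    = q^-exp
          ; failure-≤ = failure-≤
          ; error-≤   = grid-error-≤
          }

      calibration : ∀ {ρ} → 0# < ρ → 1# + β ≤ r → Calibration ε (1# + β) r ρ (α ρ) δ T
      calibration 0<ρ 1+β≤r =
        -- The resolution m = `suc n` is chosen to be at least ε, which yields θ ≤ 1; K is the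
        -- integer part of log r / log (1 + β).
        let n , ε<n*1 , _      = archimedean 0<1 ε
            K , KL≤A , A<[1+K]L = floor 0<L 0≤A
        in Resolution.resolution 0<ρ L≤A (suc n) K (0<fromℕ (suc n))
             (≤-trans ε<n*1 (≤-trans (≤-reflexive (*-identityʳ _)) (fromℕ-mono-≤ (ℕ.n≤1+n n))))
             KL≤A (proj₁ A<[1+K]L)
        where
        L≤A : L ≤ A
        L≤A = exp-cancel-≤ 0≤A (≤-trans (≤-reflexive expL≈1+β) (≤-trans 1+β≤r (≤-reflexive (sym expA≈r))))

    -- The ladder of powers of b.

    module Ladder {b grid r : ℝ} (K : ℕ)
      (1≤b : 1# ≤ b) (0<grid : 0# < grid) (r≤b^[1+K] : r ≤ b ^ suc K) where

      Reached : ℕ → ℕ → Set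
      Reached w k = b ^ k ≤ fromℕ w * grid

      rung : ℕ → ℕ
      rung w = greatest (Reached w) K

      rung≤K : ∀ w → rung w ℕ.≤ K
      rung≤K w = greatest-≤ (Reached w) K

      rung-mono : ∀ {v w} → v ℕ.≤ w → rung v ℕ.≤ rung w
      rung-mono v≤w = greatest-mono (λ p → ≤-trans p (*-monoʳ-≤ (proj₁ 0<grid) (fromℕ-mono-≤ v≤w))) K

      -- One power above the rung, so that rounding never underestimates: multiplicative error is
      -- allowed only upwards.
      value : ℕ → ℝ
      value k = b ^ suc k

      value-mono : ∀ {j k} → j ℕ.≤ k → value j ≤ value k
      value-mono j≤k = ^-mono-exponent 1≤b (s≤s j≤k)

      -- Below the top the next power is not reached; at the top the value is at least r.
      rung-value-≥ : ∀ w → fromℕ w * grid ≤ r → fromℕ w * grid ≤ value (rung w)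
      rung-value-≥ w w≤r = reach (ℕ.m≤n⇒m<n∨m≡n (rung≤K w))
        where
        reach : rung w ℕ.< K ⊎ rung w ≡ K → fromℕ w * grid ≤ value (rung w)
        reach (inj₁ rung<K) = ≮⇒≥ λ value< → ℕ.<-irrefl ≡.refl
          (greatest-maximal (Reached w) K rung<K (proj₁ value<))
        reach (inj₂ rung≡K) = ≤-trans w≤r (≤-trans r≤b^[1+K]
          (≤-reflexive (reflexive (≡.cong value (≡.sym rung≡K)))))

      rung-value-≤ : ∀ w {y} → 1# ≤ y → fromℕ w * grid ≤ y → value (rung w) ≤ b * y
      rung-value-≤ w 1≤y w≤y = *-monoˡ-≤ (≤-trans 0≤1 1≤b) (reach (greatest-holds (Reached w) K))
        where
        reach : rung w ≡ 0 ⊎ Reached w (rung w) → b ^ rung w ≤ _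
        -- Rung 0 is also the default when no power is reached, so it is justified by 1 ≤ y alone.
        reach (inj₁ ≡0) = ≤-trans (≤-reflexive (reflexive (≡.cong (b ^_) ≡0))) 1≤y
        reach (inj₂ p)  = ≤-trans p w≤y

    -- The algorithms for a monotone function.

    module _ (𝒫 : DynamicProblem) where

      open DynamicProblem 𝒫

      module _ (g : Data → ℝ) where

        open Deterministic g

        deterministic-private : ∀ {T ε} → 0# ≤ ε → (∀ {G G′} → G ∼ G′ → g G ≈ g G′) →
                                DifferentiallyPrivate 𝒫 ε (algorithm T)
        deterministic-private 0≤ε g-const {us} {us′} v v′ adj {S} borel = begin
          𝟙 (S (outputs (states us) tt))           ≤⟨ 𝟙-mono-≤ (borel-resp borel same) ⟩
          𝟙 (S (outputs (states us′) tt))          ≈⟨ *-identityˡ _ ⟨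
          1# * 𝟙 (S (outputs (states us′) tt))     ≤⟨ *-monoʳ-≤ (0≤𝟙 _) (1≤exp 0≤ε) ⟩
          exp _ * 𝟙 (S (outputs (states us′) tt))  ∎
          where
          open DynamicAlgorithm (algorithm _) using (outputs)
          same : ∀ t → g (last (truncate (toℕ<n t) (states us))) ≈
                       g (last (truncate (toℕ<n t) (states us′)))
          same t rewrite last-truncate (states us) t | last-truncate (states us′) t
            with states-adjacent v v′ adj t
          ... | inj₁ G≡G′ = reflexive (≡.cong g G≡G′)
          ... | inj₂ G∼G′ = g-const G∼G′

        deterministic-computes : ∀ {T f μ α δ} → 0# ≤ δ → (∀ G → f G - α ≤ g G × g G ≤ μ * f G + α) →
                                 Computes 𝒫 f μ α δ (algorithm T)
        deterministic-computes {f = f} {μ} {α} {δ} 0≤δ close {us} v = ≤-trans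
          (≤-by δ 0≤δ (solve 1 (λ δ → :1 := :1 :- δ :+ δ) refl δ))
          (≤-reflexive (sym (𝟙-true λ t →
            ≡.subst (λ a → f (lookup (states us) t) - α ≤ a × a ≤ μ * f (lookup (states us) t) + α)
              (≡.cong g (≡.sym (last-truncate (states us) t))) (close (lookup (states us) t)))))

      module _ {ε β r ρ δ α : ℝ} (0<ε : 0# < ε) (0<β : 0# < β) (0<δ : 0# < δ) (0≤α : 0# ≤ α)
        (f : Data → ℝ) (range : HasRange 𝒫 1# r f) (mono : MonotoneOnAllInputs 𝒫 f)
        (sensitivity : IsSensitivity 𝒫 f ρ) (T : ℕ)
        where

        1≤1+β : 1# ≤ 1# + β
        1≤1+β = ≤-by β (proj₁ 0<β) refl

        0≤1+β : 0# ≤ 1# + β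
        0≤1+β = ≤-trans 0≤1 1≤1+β

        f-stable : ∀ {G G′} → G ∼ G′ → f G ≤ f G′ + ρ × f G′ ≤ f G + ρ
        f-stable {G} {G′} G∼G′ =
          let ∣∣≤ρ = proj₂ (proj₁ sensitivity) G∼G′
          in ∣x-y∣≤⇒x≤ (f G) (f G′) ∣∣≤ρ , ∣x-y∣≤⇒y≤ (f G) (f G′) ∣∣≤ρ

        y-α≤y : ∀ y → y - α ≤ y
        y-α≤y y = ≤-by α 0≤α (solve 2 (λ y α → y := y :- α :+ α) refl y α)

        y≤y+α : ∀ y → y ≤ y + α
        y≤y+α y = ≤-by α 0≤α refl

        1+β≤[1+β]y : ∀ {y} → 1# ≤ y → 1# + β ≤ (1# + β) * y
        1+β≤[1+β]y 1≤y = ≤-trans (≤-reflexive (sym (*-identityʳ _))) (*-monoˡ-≤ 0≤1+β 1≤y)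

        Solution : Set₂
        Solution = ∃ λ (𝒜 : DynamicAlgorithm Data T) →
          DifferentiallyPrivate 𝒫 ε 𝒜 × Computes 𝒫 f (1# + β) α δ 𝒜

        insensitive-solution : ρ ≤ 0# → Solution
        insensitive-solution ρ≤0 = Deterministic.algorithm f T
          , deterministic-private f (proj₁ 0<ε) (λ G∼G′ →
              let p , q = f-stable G∼G′ in antisym (drop p) (drop q))
          , deterministic-computes f (proj₁ 0<δ) λ G → y-α≤y (f G) , (begin
              f G                  ≈⟨ *-identityˡ _ ⟨
              1# * f G             ≤⟨ *-monoʳ-≤ (≤-trans 0≤1 (proj₁ (range G))) 1≤1+β ⟩
              (1# + β) * f G       ≤⟨ y≤y+α _ ⟩
              (1# + β) * f G + α   ∎)
          where
          drop : ∀ {x y} → x ≤ y + ρ → x ≤ y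
          drop x≤y+ρ = ≤-trans x≤y+ρ (≤-trans (+-mono-≤ ≤-refl ρ≤0) (≤-reflexive (+-identityʳ _)))

        small-range-solution : r ≤ 1# + β → Solution
        small-range-solution r≤1+β = Deterministic.algorithm (λ _ → r) T
          , deterministic-private (λ _ → r) (proj₁ 0<ε) (λ _ → refl)
          , deterministic-computes (λ _ → r) (proj₁ 0<δ) λ G →
              ≤-trans (y-α≤y (f G)) (proj₂ (range G))
            , ≤-trans r≤1+β (≤-trans (1+β≤[1+β]y (proj₁ (range G))) (y≤y+α _))

        module Sensitive (calibration : Calibration ε (1# + β) r ρ α δ T) where

          open Calibration calibration
          open Ladder K 1≤1+β 0<grid r≤b^[1+K]

          0≤f : ∀ G → 0# ≤ f G
          0≤f G = ≤-trans 0≤1 (proj₁ (range G))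

          cell : Data → ℕ
          cell G = proj₁ (floor 0<grid (0≤f G))

          cell-≤ : ∀ G → fromℕ (cell G) * grid ≤ f G
          cell-≤ G = proj₁ (proj₂ (floor 0<grid (0≤f G)))

          cell-> : ∀ G → f G < fromℕ (suc (cell G)) * grid
          cell-> G = proj₂ (proj₂ (floor 0<grid (0≤f G)))

          cell-≤-from : ∀ G n → f G < fromℕ (suc n) * grid → cell G ℕ.≤ n
          cell-≤-from G n fG< = ℕ.s≤s⁻¹ (fromℕ-cancel-< (≰⇒> λ 1+n≤cell →
            <⇒≱ fG< (≤-trans (*-monoʳ-≤ (proj₁ 0<grid) 1+n≤cell) (cell-≤ G))))

          cell-mono : ∀ {G G′} → f G ≤ f G′ → cell G ℕ.≤ cell G′
          cell-mono {G} {G′} fG≤fG′ = cell-≤-from G (cell G′) (≤-<-trans fG≤fG′ (cell-> G′))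

          -- Since ρ is exactly m cells, rounding down does not enlarge the sensitivity beyond m.
          cell-stable : ∀ {G G′} → f G ≤ f G′ + ρ → cell G ℕ.≤ m ℕ.+ cell G′
          cell-stable {G} {G′} fG≤fG′+ρ = cell-≤-from G (m ℕ.+ cell G′) (≰⇒> λ ≤fG → <⇒≱ (cell-> G′)
            (+-cancelʳ-≤ ρ (begin
              fromℕ (suc (cell G′)) * grid + ρ                ≈⟨ +-congˡ (trans (*-comm _ _) grid*m≈ρ) ⟨
              fromℕ (suc (cell G′)) * grid + fromℕ m * grid   ≈⟨ trans (+-comm _ _) (sym (distribʳ _ _ _)) ⟩
              (fromℕ m + fromℕ (suc (cell G′))) * grid        ≈⟨ *-congʳ (fromℕ-+ m (suc (cell G′))) ⟨
              fromℕ (m ℕ.+ suc (cell G′)) * grid              ≡⟨ ≡.cong (λ n → fromℕ n * grid) (ℕ.+-suc m (cell G′)) ⟩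
              fromℕ (suc (m ℕ.+ cell G′)) * grid              ≤⟨ ≤fG ⟩
              f G                                             ≤⟨ fG≤fG′+ρ ⟩
              f G′ + ρ                                        ∎)))

          R-floor : ∃ λ n → fromℕ n * grid ≤ r × r < fromℕ (suc n) * grid
          R-floor = floor 0<grid (≤-trans (0≤f initial) (proj₂ (range initial)))

          R : ℕ
          R = proj₁ R-floor

          cell≤R : ∀ G → cell G ℕ.≤ R
          cell≤R G = cell-≤-from G R (≤-<-trans (proj₂ (range G)) (proj₂ (proj₂ R-floor)))

          -- Both directions of monotonicity lead to this range of rungs. The additive error
          -- consists of 2 i cells of noise and one cell of rounding, all on the lower side.
          value-accurate : ∀ G k → rung (cell G ℕ.∸ i ℕ.∸ i) ℕ.≤ k → k ℕ.≤ rung (cell G) →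
                           f G - α ≤ value k × value k ≤ (1# + β) * f G + α
          value-accurate G k ≤k k≤ = lower
            , ≤-trans (value-mono k≤) (≤-trans (rung-value-≤ (cell G) (proj₁ (range G)) (cell-≤ G)) (y≤y+α _))
            where
            w = cell G ℕ.∸ i ℕ.∸ i

            w≤r : fromℕ w * grid ≤ r
            w≤r = begin
              fromℕ w * grid         ≤⟨ *-monoʳ-≤ (proj₁ 0<grid)
                                          (fromℕ-mono-≤ (ℕ.≤-trans (ℕ.m∸n≤m _ i) (ℕ.m∸n≤m _ i))) ⟩
              fromℕ (cell G) * grid  ≤⟨ cell-≤ G ⟩
              f G                    ≤⟨ proj₂ (range G) ⟩
              r                      ∎

            1+cell≤ : suc (cell G) ℕ.≤ w ℕ.+ suc (i ℕ.+ i)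
            1+cell≤ = ≡.subst₂ ℕ._≤_ ≡.refl (≡.sym (ℕ.+-suc w (i ℕ.+ i))) (s≤s
              (≡.subst (λ v → cell G ℕ.≤ v ℕ.+ (i ℕ.+ i)) (≡.sym (ℕ.∸-+-assoc (cell G) i i))
                (≡.subst (cell G ℕ.≤_) (ℕ.+-comm (i ℕ.+ i) _) (ℕ.m≤n+m∸n (cell G) (i ℕ.+ i)))))

            lower : f G - α ≤ value k
            lower = begin
              f G - α
                ≤⟨ +-monoˡ-≤ (- α) (proj₁ (cell-> G)) ⟩
              fromℕ (suc (cell G)) * grid - α
                ≤⟨ +-mono-≤ (*-monoʳ-≤ (proj₁ 0<grid) (fromℕ-mono-≤ 1+cell≤)) (neg-mono-≤ error-≤) ⟩
              fromℕ (w ℕ.+ suc (i ℕ.+ i)) * grid - grid * e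
                ≈⟨ +-congʳ (*-congʳ (fromℕ-+ w (suc (i ℕ.+ i)))) ⟩
              (fromℕ w + e) * grid - grid * e
                ≈⟨ solve 3 (λ w e g → (w :+ e) :* g :- g :* e := w :* g) refl (fromℕ w) e grid ⟩
              fromℕ w * grid    ≤⟨ rung-value-≥ w w≤r ⟩
              value (rung w)    ≤⟨ value-mono ≤k ⟩
              value k           ∎
              where e = fromℕ (suc (i ℕ.+ i))

          module Tracked
            (level : ℕ → ℕ) (level-mono : ∀ {v w} → v ℕ.≤ w → level v ℕ.≤ level w)
            (level≤K : ∀ v → level v ℕ.≤ K)
            (score : Data → ℕ) (score≤R : ∀ G → score G ℕ.≤ R) (output : ℕ → ℝ)
            where

            open SparseVector q 0≤q q≤1 R K m level level-mono level≤K

            solution :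
              (∀ {G G′} → G ∼ G′ → score G ≃ score G′) →
              (∀ {T} {us : Vec Update T} → Valid us → ∀ {s t} → s Fin.≤ t →
                 score (lookup (states us) s) ℕ.≤ score (lookup (states us) t)) →
              (∀ G j → level (score G ℕ.∸ i) ℕ.≤ j → j ℕ.≤ level (score G ℕ.+ i) →
                 f G - α ≤ output j × output j ≤ (1# + β) * f G + α) →
              Solution
            solution stable incr accurate = algorithm score output T
              , (λ {us} {us′} v v′ adj {S} borel → q^-exp
                  (algorithm-private score output score≤R (states us) (states us′)
                    (λ t → adjacent (states-adjacent v v′ adj t)) borel))
              , λ {us} v → ≤-trans
                  (≤-by (δ - fromℕ (suc T) * q ^ i) (x≤y⇒0≤y-x failure-≤)
                    (solve 2 (λ δ p → :1 :- p := :1 :- δ :+ (δ :- p)) refl δ (fromℕ (suc T) * q ^ i)))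
                  (algorithm-accurate score output score≤R i (states us) (incr v)
                    (λ t a → (f (lookup (states us) t) - α ≤ a) × (a ≤ (1# + β) * f (lookup (states us) t) + α))
                    (λ t → accurate (lookup (states us) t)))
              where
              adjacent : ∀ {G G′} → G ≡ G′ ⊎ G ∼ G′ → score G ≃ score G′
              adjacent (inj₁ ≡.refl) = ℕ.m≤n+m _ m , ℕ.m≤n+m _ m
              adjacent (inj₂ G∼G′)   = stable G∼G′

          cell-≃ : ∀ {G G′} → G ∼ G′ → cell G ℕ.≤ m ℕ.+ cell G′ × cell G′ ℕ.≤ m ℕ.+ cell G
          cell-≃ G∼G′ = let p , p′ = f-stable G∼G′ in cell-stable p , cell-stable p′

          -- The shift of the levels by i moves the possible scores from x ± i down to the range
          -- from x - 2 i to x.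
          nonDecreasing-solution : NonDecreasing 𝒫 f → Solution
          nonDecreasing-solution f-mono = Tracked.solution
            (λ v → rung (v ℕ.∸ i)) (rung-mono ∘ ℕ.∸-monoˡ-≤ i) (λ v → rung≤K (v ℕ.∸ i)) cell cell≤R value
            cell-≃ (λ v s≤t → cell-mono (f-mono v s≤t))
            λ G j ≤j j≤ → value-accurate G j ≤j
              (≡.subst (λ w → j ℕ.≤ rung w) (ℕ.m+n∸n≡m (cell G) i) j≤)

          -- Scores are reflected in R and states in K: a state counts the rungs descended from the
          -- top, so the initial state 0 stands for the largest output, and states still only
          -- increase.
          nonIncreasing-solution : NonIncreasing 𝒫 f → Solution
          nonIncreasing-solution f-anti = Tracked.solution
            (λ v → K ℕ.∸ rung (R ℕ.∸ v ℕ.∸ i))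
            (λ v≤w → ℕ.∸-monoʳ-≤ K (rung-mono (ℕ.∸-monoˡ-≤ i (ℕ.∸-monoʳ-≤ R v≤w))))
            (λ v → ℕ.m∸n≤m K (rung (R ℕ.∸ v ℕ.∸ i)))
            (λ G → R ℕ.∸ cell G) (λ G → ℕ.m∸n≤m R (cell G))
            (λ j → value (K ℕ.∸ j))
            (λ G∼G′ → let p , p′ = cell-≃ G∼G′ in reflect p′ , reflect p)
            (λ v s≤t → ℕ.∸-monoʳ-≤ R (cell-mono (f-anti v s≤t)))
            λ G j ≤j j≤ → value-accurate G (K ℕ.∸ j)
              (ℕ.≤-trans (ℕ.≤-reflexive (≡.trans (≡.cong rung (lower-end G))
                  (≡.sym (ℕ.m∸[m∸n]≡n (rung≤K (R ℕ.∸ (R ℕ.∸ cell G ℕ.+ i) ℕ.∸ i))))))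
                (ℕ.∸-monoʳ-≤ K j≤))
              (ℕ.≤-trans (ℕ.∸-monoʳ-≤ K ≤j) (ℕ.≤-trans
                (ℕ.≤-reflexive (ℕ.m∸[m∸n]≡n (rung≤K (R ℕ.∸ (R ℕ.∸ cell G ℕ.∸ i) ℕ.∸ i))))
                (rung-mono (upper-end G))))
            where
            reflect : ∀ {z z′} → z′ ℕ.≤ m ℕ.+ z → R ℕ.∸ z ℕ.≤ m ℕ.+ (R ℕ.∸ z′)
            reflect {z} {z′} z′≤m+z = ℕ.m≤n+o⇒m∸n≤o R z (ℕ.≤-trans (ℕ.m≤n+m∸n R z′)
              (ℕ.≤-trans (ℕ.+-monoˡ-≤ (R ℕ.∸ z′) z′≤m+z) (ℕ.≤-reflexive
                (≡.trans (≡.cong (ℕ._+ (R ℕ.∸ z′)) (ℕ.+-comm m z)) (ℕ.+-assoc z m (R ℕ.∸ z′))))))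

            lower-end : ∀ G → cell G ℕ.∸ i ℕ.∸ i ≡ R ℕ.∸ (R ℕ.∸ cell G ℕ.+ i) ℕ.∸ i
            lower-end G = ≡.cong (ℕ._∸ i) (≡.trans
              (≡.cong (ℕ._∸ i) (≡.sym (ℕ.m∸[m∸n]≡n (cell≤R G)))) (ℕ.∸-+-assoc R (R ℕ.∸ cell G) i))

            -- Only an inequality, unlike `lower-end`: for a reflected score below i the subtraction
            -- is cut off at 0.
            upper-end : ∀ G → R ℕ.∸ (R ℕ.∸ cell G ℕ.∸ i) ℕ.∸ i ℕ.≤ cell G
            upper-end G = ℕ.m≤n+o⇒m∸n≤o _ i (ℕ.m≤n+o⇒m∸n≤o R (R ℕ.∸ cell G ℕ.∸ i)
              (ℕ.≤-trans (ℕ.m≤n+m∸n R (cell G)) (ℕ.≤-trans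
                (ℕ.+-monoʳ-≤ (cell G) (ℕ.m≤n+m∸n (R ℕ.∸ cell G) i))
                (ℕ.≤-reflexive (rearrange (cell G) i (R ℕ.∸ cell G ℕ.∸ i))))))
              where
              rearrange : ∀ c i w → c ℕ.+ (i ℕ.+ w) ≡ w ℕ.+ (i ℕ.+ c)
              rearrange c i w = ≡.trans (ℕ.+-comm c (i ℕ.+ w))
                (≡.trans (≡.cong (ℕ._+ c) (ℕ.+-comm i w)) (ℕ.+-assoc w i c))

        solution : (0# < ρ → 1# + β ≤ r → Calibration ε (1# + β) r ρ α δ T) → Solution
        -- The grid width ρ / m must be positive, and the charge for the threshold noise is covered
        -- by log r only if 1 + β ≤ r.
        solution calibration with total r (1# + β) | em {0# < ρ}
        ... | inj₁ r≤1+β | _       = small-range-solution r≤1+β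
        ... | inj₂ 1+β≤r | no  0≮ρ = insensitive-solution (≮⇒≥ 0≮ρ)
        ... | inj₂ 1+β≤r | yes 0<ρ =
          [ nonDecreasing-solution , nonIncreasing-solution ]′ mono
          where open Sensitive (calibration 0<ρ 1+β≤r)

    private-algorithm : ∀ {δ ε β r ρ} → 0# < δ → 0# < ε → 0# < β →
      (𝒫 : DynamicProblem) → let open DynamicProblem 𝒫 in
      (f : Data → ℝ) → HasRange 𝒫 1# r f → MonotoneOnAllInputs 𝒫 f → IsSensitivity 𝒫 f ρ →
      (T : ℕ) → 2 ℕ.≤ T →
      ∃ λ (𝒜 : DynamicAlgorithm Data T) →
        DifferentiallyPrivate 𝒫 ε 𝒜 ×
        Computes 𝒫 f (1# + β) (errorConstant δ * ((ρ * log r * log (fromℕ T)) / (ε * log (1# + β)))) δ 𝒜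
    private-algorithm 0<δ 0<ε 0<β 𝒫 f range mono sensitivity T 2≤T =
      solution 𝒫 0<ε 0<β 0<δ (α-nonneg (proj₁ (proj₁ sensitivity))) f range mono sensitivity T calibration
      where
      open DynamicProblem 𝒫 using (initial)
      1≤r = ≤-trans (proj₁ (range initial)) (proj₂ (range initial))
      open Calibrate 0<ε 0<β 1≤r 0<δ T 2≤T

theorem2 :
    (em : ExcludedMiddle 0ℓ) (ℛ : RealNumbers) →
    let open RealNumbers ℛ
        open Privacy em ℛ
    in
    (δ : ℝ) → 0# < δ →
    ∃ λ (C : ℝ) → 0# < C ×
      ((ε β r ρ : ℝ) → 0# < ε → 0# < β → 0# < r →
       (𝒫 : DynamicProblem) →
       let open DynamicProblem 𝒫 in
       (f : Data → ℝ) →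
       HasRange 𝒫 1# r f →
       MonotoneOnAllInputs 𝒫 f →
       IsSensitivity 𝒫 f ρ →
       (T : ℕ) → 2 ℕ.≤ T →
       ∃ λ (𝒜 : DynamicAlgorithm Data T) →
         DifferentiallyPrivate 𝒫 ε 𝒜 ×
         Computes 𝒫 f (1# + β)
           (C * ((ρ * log r * log (fromℕ T)) / (ε * log (1# + β))))
           δ 𝒜)
theorem2 em ℛ δ 0<δ =
    Monotone.errorConstant em ℛ δ
  , Monotone.errorConstant-pos em ℛ 0<δ
  , λ ε β r ρ 0<ε 0<β _ 𝒫 f range mono sensitivity T 2≤T →
      Monotone.private-algorithm em ℛ 0<δ 0<ε 0<β 𝒫 f range mono sensitivity T 2≤T
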